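{- Let $\Lambda\in\{\mathrm{K},\mathrm{GL}\}$, let $\vec r=\langle r_0,\dots,r_{n-1}\rangle$ be a finite tuple of parameters and let $\varphi\in\mathrm{Fm}(p,\vec r)$. Then $\varphi$ is $\Lambda$-additive (with respect to $p$) if and only if $\varphi$ is $\Lambda$-equivalent to a formula from $$A_0=\Bigl\{\bigvee\Delta_0\vee\varkappa \;\Bigm|\; \Delta_0 \text{ a finite subset of } \Delta,\ \varkappa\in\mathrm{Fm}(\vec r)\Bigr\},$$ where $\Delta$ is the set of all $\delta$-formulas (with parameters $\vec r$).
   Context: Modal formulas are built from propositional variables using Boolean connectives, $\bot$, $\top$, $\Diamond$ and $\Box$. The variables $p$ and $q$ are distinct non-parameter variables; parameters are variables distinct from $p$ and $q$. $\mathrm{Fm}(p,\vec r)$ is the set of modal formulas containing no variables other than $p,r_0,\dots,r_{n-1}$; $\mathrm{Fm}(\vec r)$ is the set of modal formulas containing no variables other than $r_0,\dots,r_{n-1}$. A $\delta$-formula is a formula of the form $\delta_{\vec\varkappa}=\varkappa_0\wedge\Diamond(\varkappa_1\wedge\dots\wedge\Diamond(\varkappa_m\wedge p)\dots)$ with $m\ge 0$ and $\varkappa_0,\dots,\varkappa_m\in\mathrm{Fm}(\vec r)$ (for $m=0$ it is $\varkappa_0\wedge p$). For a normal modal logic $\Lambda$, formulas $\varphi,\psi$ are $\Lambda$-equivalent if $\Lambda\vdash\varphi\leftrightarrow\psi$. A formula $\varphi(p,\vec r)$ is $\Lambda$-additive if $\Lambda\vdash\varphi(p\vee q,\vec r)\leftrightarrow\varphi(p,\vec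 r)\vee\varphi(q,\vec r)$. $\mathrm{K}$ is the least normal modal logic and $\mathrm{GL}$ is the G\"odel--L\"ob logic, $\mathrm{K}$ plus $\Box(\Box p\to p)\to\Box p$. An empty disjunction is $\bot$. -}

module Defs where

open import Data.Bool using (Bool; true; false; not; if_then_else_) renaming (_∧_ to _&&_; _∨_ to _||_)
open import Data.List using (List; foldr)
open import Data.List.Relation.Unary.All using () renaming (All to Allᴸ)
open import Data.Nat using (ℕ; suc; _≟_)
open import Data.Product using (_×_; ∃-syntax)
open import Data.Unit using (⊤)
open import Data.Vec using (Vec; []; _∷_)
open import Data.Vec.Membership.Propositional using (_∈_)
open import Data.Vec.Relation.Unary.All using (All)
open import Level using (0ℓ)
open import Relation.Binary.PropositionalEquality using (_≡_)
open import Relation.Nullary using (does)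
open import Relation.Unary using (Pred; ∅; ｛_｝)

Var : Set
Var = ℕ

infixr 7 _`∧_
infixr 6 _`∨_
infixr 5 _`→_
infix  4 _`↔_

data Formula : Set where
  var            : Var → Formula
  `⊥ `⊤          : Formula
  _`∧_ _`∨_ _`→_ : Formula → Formula → Formula
  ◇ □            : Formula → Formula

`¬ : Formula → Formula
`¬ φ = φ `→ `⊥

_`↔_ : Formula → Formula → Formula
φ `↔ ψ = (φ `→ ψ) `∧ (ψ `→ φ)

⋁ : List Formula → Formula
⋁ = foldr _`∨_ `⊥

-- φ ∈Fm[ xs ]: φ contains no variables other than those listed in xs.
infix 4 _∈Fm[_]
_∈Fm[_] : ∀ {n} → Formula → Vec Var n → Set
var x    ∈Fm[ xs ] = x ∈ xs
`⊥       ∈Fm[ xs ] = ⊤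
`⊤       ∈Fm[ xs ] = ⊤
(φ `∧ ψ) ∈Fm[ xs ] = φ ∈Fm[ xs ] × ψ ∈Fm[ xs ]
(φ `∨ ψ) ∈Fm[ xs ] = φ ∈Fm[ xs ] × ψ ∈Fm[ xs ]
(φ `→ ψ) ∈Fm[ xs ] = φ ∈Fm[ xs ] × ψ ∈Fm[ xs ]
◇ φ      ∈Fm[ xs ] = φ ∈Fm[ xs ]
□ φ      ∈Fm[ xs ] = φ ∈Fm[ xs ]

substitute : (Var → Formula) → Formula → Formula
substitute σ (var x)  = σ x
substitute σ `⊥       = `⊥
substitute σ `⊤       = `⊤
substitute σ (φ `∧ ψ) = substitute σ φ `∧ substitute σ ψ
substitute σ (φ `∨ ψ) = substitute σ φ `∨ substitute σ ψ
substitute σ (φ `→ ψ) = substitute σ φ `→ substitute σ ψ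
substitute σ (◇ φ)    = ◇ (substitute σ φ)
substitute σ (□ φ)    = □ (substitute σ φ)

infix 8 _[_≔_]
_[_≔_] : Formula → Var → Formula → Formula
φ [ p ≔ χ ] = substitute (λ x → if does (x ≟ p) then χ else var x) φ

-- Classical truth value, with variables and formulas ◇ φ, □ φ treated as
-- propositional atoms valued by v.
eval : (Formula → Bool) → Formula → Bool
eval v (var x)  = v (var x)
eval v `⊥       = false
eval v `⊤       = true
eval v (φ `∧ ψ) = eval v φ && eval v ψ
eval v (φ `∨ ψ) = eval v φ || eval v ψ
eval v (φ `→ ψ) = not (eval v φ) || eval v ψ
eval v (◇ φ)    = v (◇ φ)
eval v (□ φ)    = v (□ φ)

Tautology : Formula → Set
Tautology φ = ∀ v → eval v φ ≡ true

-- The least normal modal logic containing Ax. Since ◇ and □ are both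
-- primitive, their duality is an axiom.
data Derivable (Ax : Pred Formula 0ℓ) : Formula → Set where
  axiom : ∀ {φ} → Ax φ → Derivable Ax φ
  taut  : ∀ {φ} → Tautology φ → Derivable Ax φ
  dist  : ∀ {φ ψ} → Derivable Ax (□ (φ `→ ψ) `→ □ φ `→ □ ψ)
  dual  : ∀ {φ} → Derivable Ax (◇ φ `↔ `¬ (□ (`¬ φ)))
  mp    : ∀ {φ ψ} → Derivable Ax (φ `→ ψ) → Derivable Ax φ → Derivable Ax ψ
  nec   : ∀ {φ} → Derivable Ax φ → Derivable Ax (□ φ)
  sub   : ∀ {φ} (σ : Var → Formula) → Derivable Ax φ → Derivable Ax (substitute σ φ)

data Logic : Set where
  K GL : Logic

-- The variable in Löb's axiom is immaterial, by closure under substitution.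
axioms : Logic → Pred Formula 0ℓ
axioms K  = ∅
axioms GL = ｛ □ (□ (var 0) `→ var 0) `→ □ (var 0) ｝

infix 3 _⊢_
_⊢_ : Logic → Formula → Set
Λ ⊢ φ = Derivable (axioms Λ) φ

Equivalent : Logic → Formula → Formula → Set
Equivalent Λ φ ψ = Λ ⊢ φ `↔ ψ

Additive : Logic → (p q : Var) → Formula → Set
Additive Λ p q φ = Λ ⊢ φ [ p ≔ var p `∨ var q ] `↔ φ `∨ φ [ p ≔ var q ]

δ : ∀ {m} → Var → Vec Formula (suc m) → Formula
δ p (ϰ ∷ [])         = ϰ `∧ var p
δ p (ϰ ∷ ϰs@(_ ∷ _)) = ϰ `∧ ◇ (δ p ϰs)

Δ : ∀ {n} → Var → Vec Var n → Pred Formula 0ℓ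
Δ p r ψ = ∃[ m ] ∃[ ϰs ] All (_∈Fm[ r ]) ϰs × ψ ≡ δ {m} p ϰs

-- Finite subsets of Δ are enumerated by lists; order and repetitions affect
-- the disjunction only up to equivalence in every normal modal logic.
A₀ : ∀ {n} → Var → Vec Var n → Pred Formula 0ℓ
A₀ p r ψ = ∃[ Δ₀ ] ∃[ ϰ ] Allᴸ (Δ p r) Δ₀ × ϰ ∈Fm[ r ] × ψ ≡ ⋁ Δ₀ `∨ ϰ

{-# OPTIONS --safe #-}
module Submission where

-- Both logics are complete for finite trees, where □ ranges over the children
-- (K) or over the proper descendants (GL). If φ is additive and true at the
-- root of a tree with p true on a set P of nodes, then after doubling all
-- subtrees φ is true already with P empty or cut down to a single node. In
-- the latter case all that matters is the path to that node, and of each node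
-- on it only the truth values, with p := ⊥, of the atoms of φ: the p-free copy
-- of its subtree simulates everything off the path. A δ-formula expresses
-- that a path with these values exists, so φ is the disjunction of φ[p ≔ ⊥]
-- and of all δ-formulas of this kind that imply φ. Only finitely many are
-- needed: for K, p is invisible beyond the modal depth of φ, and for GL, path
-- nodes that add nothing to what fails further along can be skipped.

open import Defs
open import Data.Bool using (Bool; true; false; not; if_then_else_) renaming (_∧_ to _&&_; _∨_ to _||_)
open import Data.Bool.Properties using (∨-identityʳ; ∨-idem; ∧-distribˡ-∨; not-injective)
open import Data.Empty using (⊥; ⊥-elim)
open import Data.List using (List; []; _∷_; _++_; foldr; map; length; filter; concatMap; cartesianProductWith; upTo)
open import Data.List.Membership.Propositional using (lose) renaming (_∈_ to _∈ᴸ_)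
open import Data.List.Membership.Propositional.Properties using (∈-++⁺ˡ; ∈-++⁺ʳ; ∈-++⁻; ∈-map⁺; ∈-map⁻; ∈-cartesianProductWith⁺; ∈-concatMap⁺; ∈-concatMap⁻; ∈-filter⁺; ∈-filter⁻; ∈-upTo⁺)
open import Data.List.Relation.Binary.Pointwise using (Pointwise; []; _∷_)
open import Data.List.Relation.Unary.All using (tabulate; lookup) renaming (All to Allᴸ; [] to []ᴬ; _∷_ to _∷ᴬ_)
open import Data.List.Relation.Unary.All.Properties using (++⁺; ++⁻ˡ; ++⁻ʳ)
open import Data.List.Relation.Unary.Any using (here; there; satisfied)
open import Data.Nat using (ℕ; zero; suc; _+_; _≤_; _<_; z≤n; s≤s; _⊔_; _≟_; _≤?_)
open import Data.Nat.Properties using (≤-refl; ≤-trans; ≤-pred; ≰⇒>; ⊔-lub; m≤m⊔n; m≤n⊔m; m≤n⇒m≤1+n)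
open import Data.Product using (Σ; _×_; _,_; proj₁; proj₂; ∃-syntax)
open import Data.Sum using (_⊎_; inj₁; inj₂)
open import Data.Unit using (⊤; tt)
open import Data.Vec as Vec using (Vec; []; _∷_)
open import Data.Vec.Membership.Propositional using (_∉_)
open import Data.Vec.Relation.Unary.All using (All; []; _∷_)
open import Data.Vec.Relation.Unary.Any using (here; there)
open import Function using (_∘_; id)
open import Function.Bundles using (_⇔_; mk↣; mk⇔)
open import Relation.Binary.Definitions using (DecidableEquality)
open import Relation.Binary.PropositionalEquality using (_≡_; _≢_; refl; sym; trans; cong; cong₂; subst)
open import Relation.Nullary using (¬_; Dec; yes; no; does)
open import Relation.Nullary.Decidable using (dec-true; dec-false; via-injection)

-- Additivity says that if φ holds with p true on P₁ ∪ P₂, then it holds with p true on P₁ alone or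
-- on P₂ alone; the fresh q carries the second set. Splitting P down to one node is not enough: a
-- δ-formula asserts that some path exists and says nothing about p elsewhere, while the truth of φ
-- depends on whole subtrees. Doubling repairs this: a child that keeps p has a p-free twin, so what
-- hangs off the path is described by the p-free values of the nodes on it. The way back rests on
-- monotonicity in p, which additivity entails: a path with the right values in any tree yields φ in
-- the track of that path, hence in the tree itself. So the δ-formula implies φ, and summands can be
-- selected by derivability. This selection has to be effective; completeness is therefore proved as
-- a decision procedure that returns a derivation or a finite countermodel, with truth in trees
-- valued in `Bool`.

&&-true⁺ : ∀ {a b} → a ≡ true → b ≡ true → a && b ≡ true
&&-true⁺ refl refl = refl

&&-true⁻ : ∀ {a b} → a && b ≡ true → a ≡ true × b ≡ true
&&-true⁻ {true} e = refl , e

||-true⁺ˡ : ∀ {a b} → a ≡ true → a || b ≡ true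
||-true⁺ˡ refl = refl

||-true⁺ʳ : ∀ {a b} → b ≡ true → a || b ≡ true
||-true⁺ʳ {true}  _ = refl
||-true⁺ʳ {false} e = e

||-true⁻ : ∀ {a b} → a || b ≡ true → a ≡ true ⊎ b ≡ true
||-true⁻ {true}  _ = inj₁ refl
||-true⁻ {false} e = inj₂ e

imp-true⁺ : ∀ {a b} → (a ≡ true → b ≡ true) → not a || b ≡ true
imp-true⁺ {true}  f = f refl
imp-true⁺ {false} _ = refl

imp-true⁻ : ∀ {a b} → not a || b ≡ true → a ≡ true → b ≡ true
imp-true⁻ e refl = e

imp-false⁻ : ∀ {a b} → not a || b ≡ false → a ≡ true × b ≡ false
imp-false⁻ {true} e = refl , e

neg-true⁺ : ∀ {a} → a ≡ false → not a || false ≡ true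
neg-true⁺ refl = refl

neg-true⁻ : ∀ {a} → not a || false ≡ true → a ≡ false
neg-true⁻ {false} _ = refl

neg-false⁻ : ∀ {a} → not a || false ≡ false → a ≡ true
neg-false⁻ {true} _ = refl

true≢false : ∀ {a} {A : Set} → a ≡ true → a ≡ false → A
true≢false refl ()

≢true⇒≡false : ∀ {a} → ¬ a ≡ true → a ≡ false
≢true⇒≡false {true}  f = ⊥-elim (f refl)
≢true⇒≡false {false} _ = refl

bool-split : ∀ a → a ≡ true ⊎ a ≡ false
bool-split true  = inj₁ refl
bool-split false = inj₂ refl

true-ext : ∀ {a b} → (a ≡ true → b ≡ true) → (b ≡ true → a ≡ true) → a ≡ b
true-ext {true}  {b}     f _ = sym (f refl)
true-ext {false} {true}  _ g = g refl
true-ext {false} {false} _ _ = refl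

search : ∀ {X : Set} {P Q : X → Set} (xs : List X) → (∀ {x} → x ∈ᴸ xs → P x ⊎ Q x) →
         (∀ {x} → x ∈ᴸ xs → P x) ⊎ (∃[ x ] x ∈ᴸ xs × Q x)
search []       f = inj₁ λ ()
search (x ∷ xs) f with f (here refl) | search xs (f ∘ there)
... | inj₂ q | _                  = inj₂ (x , here refl , q)
... | inj₁ _ | inj₂ (y , y∈ , q)  = inj₂ (y , there y∈ , q)
... | inj₁ p | inj₁ g             = inj₁ λ { (here refl) → p ; (there y∈) → g y∈ }

-- Atoms and propositional consequence

-- Comparing formulas directly takes a case for each pair of constructors. Binary trees with numeral
-- tags have only two constructors, and formulas embed into them.
data Code : Set where
  leaf : ℕ → Code
  _⟨_⟩_ : Code → ℕ → Code → Code

_≟ᶜ_ : DecidableEquality Code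
leaf m ≟ᶜ leaf n with m ≟ n
... | yes refl = yes refl
... | no m≢n   = no λ { refl → m≢n refl }
leaf _ ≟ᶜ (_ ⟨ _ ⟩ _) = no λ ()
(_ ⟨ _ ⟩ _) ≟ᶜ leaf _ = no λ ()
(a ⟨ m ⟩ b) ≟ᶜ (c ⟨ n ⟩ d) with a ≟ᶜ c | m ≟ n | b ≟ᶜ d
... | yes refl | yes refl | yes refl = yes refl
... | no a≢c   | _        | _        = no λ { refl → a≢c refl }
... | yes _    | no m≢n   | _        = no λ { refl → m≢n refl }
... | yes _    | yes _    | no b≢d   = no λ { refl → b≢d refl }

encode : Formula → Code
encode (var x)  = leaf (2 + x)
encode `⊥       = leaf 0
encode `⊤       = leaf 1
encode (φ `∧ ψ) = encode φ ⟨ 0 ⟩ encode ψ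
encode (φ `∨ ψ) = encode φ ⟨ 1 ⟩ encode ψ
encode (φ `→ ψ) = encode φ ⟨ 2 ⟩ encode ψ
encode (◇ φ)    = encode φ ⟨ 3 ⟩ leaf 0
encode (□ φ)    = encode φ ⟨ 4 ⟩ leaf 0

decode : Code → Formula
decode (leaf 0)             = `⊥
decode (leaf 1)             = `⊤
decode (leaf (suc (suc x))) = var x
decode (a ⟨ 0 ⟩ b)          = decode a `∧ decode b
decode (a ⟨ 1 ⟩ b)          = decode a `∨ decode b
decode (a ⟨ 2 ⟩ b)          = decode a `→ decode b
decode (a ⟨ 3 ⟩ _)          = ◇ (decode a)
decode (a ⟨ _ ⟩ _)          = □ (decode a)

decode-encode : ∀ φ → decode (encode φ) ≡ φ
decode-encode (var x)  = refl
decode-encode `⊥       = refl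
decode-encode `⊤       = refl
decode-encode (φ `∧ ψ) = cong₂ _`∧_ (decode-encode φ) (decode-encode ψ)
decode-encode (φ `∨ ψ) = cong₂ _`∨_ (decode-encode φ) (decode-encode ψ)
decode-encode (φ `→ ψ) = cong₂ _`→_ (decode-encode φ) (decode-encode ψ)
decode-encode (◇ φ)    = cong ◇ (decode-encode φ)
decode-encode (□ φ)    = cong □ (decode-encode φ)

_≟ᶠ_ : DecidableEquality Formula
_≟ᶠ_ = via-injection (mk↣ encode-injective) _≟ᶜ_
  where
  encode-injective : ∀ {φ ψ} → encode φ ≡ encode ψ → φ ≡ ψ
  encode-injective {φ} {ψ} e = trans (sym (decode-encode φ)) (trans (cong decode e) (decode-encode ψ))

-- ◇ φ is not an atom: it is read as ¬ □ ¬ φ.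
data Atom : Set where
  var : Var → Atom
  box : Formula → Atom

⌜_⌝ : Atom → Formula
⌜ var x ⌝ = var x
⌜ box φ ⌝ = □ φ

_≟ᵃ_ : DecidableEquality Atom
var x ≟ᵃ var y with x ≟ y
... | yes refl = yes refl
... | no x≢y   = no λ { refl → x≢y refl }
var _ ≟ᵃ box _ = no λ ()
box _ ≟ᵃ var _ = no λ ()
box φ ≟ᵃ box ψ with φ ≟ᶠ ψ
... | yes refl = yes refl
... | no φ≢ψ   = no λ { refl → φ≢ψ refl }

Assignment : Set
Assignment = Atom → Bool

ev : Assignment → Formula → Bool
ev v (var x)  = v (var x)
ev v `⊥       = false
ev v `⊤       = true
ev v (φ `∧ ψ) = ev v φ && ev v ψ
ev v (φ `∨ ψ) = ev v φ || ev v ψ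
ev v (φ `→ ψ) = not (ev v φ) || ev v ψ
ev v (◇ φ)    = not (v (box (`¬ φ))) || false
ev v (□ φ)    = v (box φ)

atoms : Formula → List Atom
atoms (var x)  = var x ∷ []
atoms `⊥       = []
atoms `⊤       = []
atoms (φ `∧ ψ) = atoms φ ++ atoms ψ
atoms (φ `∨ ψ) = atoms φ ++ atoms ψ
atoms (φ `→ ψ) = atoms φ ++ atoms ψ
atoms (◇ φ)    = box (`¬ φ) ∷ atoms φ
atoms (□ φ)    = box φ ∷ atoms φ

infix 4 _⊆ᴬ_
_⊆ᴬ_ : List Atom → List Atom → Set
xs ⊆ᴬ ys = ∀ {a} → a ∈ᴸ xs → a ∈ᴸ ys

-- Lets an argument pass from a node to its successors: the body of a box in L is evaluated there
-- using atoms of L only.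
Closed : List Atom → Set
Closed L = ∀ {φ} → box φ ∈ᴸ L → atoms φ ⊆ᴬ L

++-closed : ∀ {xs ys} → Closed xs → Closed ys → Closed (xs ++ ys)
++-closed {xs} f g b∈ with ∈-++⁻ xs b∈
... | inj₁ b∈xs = ∈-++⁺ˡ ∘ f b∈xs
... | inj₂ b∈ys = ∈-++⁺ʳ xs ∘ g b∈ys

atoms-closed : ∀ φ → Closed (atoms φ)
atoms-closed (var x)  (here ())
atoms-closed (var x)  (there ())
atoms-closed (φ `∧ ψ) b∈ = ++-closed (atoms-closed φ) (atoms-closed ψ) b∈
atoms-closed (φ `∨ ψ) b∈ = ++-closed (atoms-closed φ) (atoms-closed ψ) b∈
atoms-closed (φ `→ ψ) b∈ = ++-closed (atoms-closed φ) (atoms-closed ψ) b∈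
atoms-closed (◇ φ) (here refl) a∈ with ∈-++⁻ (atoms φ) a∈
... | inj₁ a∈φ = there a∈φ
atoms-closed (◇ φ) (there b∈)  a∈ = there (atoms-closed φ b∈ a∈)
atoms-closed (□ φ) (here refl) a∈ = there a∈
atoms-closed (□ φ) (there b∈)  a∈ = there (atoms-closed φ b∈ a∈)

ev-cong : ∀ {u v} φ → (∀ {a} → a ∈ᴸ atoms φ → u a ≡ v a) → ev u φ ≡ ev v φ
ev-cong (var x)  f = f (here refl)
ev-cong `⊥       f = refl
ev-cong `⊤       f = refl
ev-cong (φ `∧ ψ) f = cong₂ _&&_ (ev-cong φ (f ∘ ∈-++⁺ˡ)) (ev-cong ψ (f ∘ ∈-++⁺ʳ (atoms φ)))
ev-cong (φ `∨ ψ) f = cong₂ _||_ (ev-cong φ (f ∘ ∈-++⁺ˡ)) (ev-cong ψ (f ∘ ∈-++⁺ʳ (atoms φ)))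
ev-cong (φ `→ ψ) f = cong₂ (λ a b → not a || b) (ev-cong φ (f ∘ ∈-++⁺ˡ)) (ev-cong ψ (f ∘ ∈-++⁺ʳ (atoms φ)))
ev-cong (◇ φ)    f = cong (λ a → not a || false) (f (here refl))
ev-cong (□ φ)    f = f (here refl)

imps : List Formula → Formula → Formula
imps Γ φ = foldr _`→_ φ Γ

ev-imps⁻ : ∀ {v} Γ {φ} → ev v (imps Γ φ) ≡ true → (∀ {ψ} → ψ ∈ᴸ Γ → ev v ψ ≡ true) → ev v φ ≡ true
ev-imps⁻ []      e f = e
ev-imps⁻ (ψ ∷ Γ) e f = ev-imps⁻ Γ (imp-true⁻ e (f (here refl))) (f ∘ there)

ev-imps⁺ : ∀ {v} Γ {φ} → ((∀ {ψ} → ψ ∈ᴸ Γ → ev v ψ ≡ true) → ev v φ ≡ true) → ev v (imps Γ φ) ≡ true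
ev-imps⁺ []      f = f λ ()
ev-imps⁺ (ψ ∷ Γ) f = imp-true⁺ λ e → ev-imps⁺ Γ λ g → f λ { (here refl) → e ; (there ψ∈) → g ψ∈ }

ev-imps-false⁻ : ∀ {v} Γ {φ} → ev v (imps Γ φ) ≡ false →
                 (∀ {ψ} → ψ ∈ᴸ Γ → ev v ψ ≡ true) × ev v φ ≡ false
ev-imps-false⁻ []      e = (λ ()) , e
ev-imps-false⁻ (ψ ∷ Γ) e =
  let e₁ , e₂ = imp-false⁻ e ; f , g = ev-imps-false⁻ Γ e₂
  in (λ { (here refl) → e₁ ; (there ψ∈) → f ψ∈ }) , g

literal : Assignment → Atom → Formula
literal v a = if v a then ⌜ a ⌝ else `¬ ⌜ a ⌝

literals : Assignment → List Atom → Formula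
literals v = foldr (λ a φ → literal v a `∧ φ) `⊤

ev-⌜⌝ : ∀ v a → ev v ⌜ a ⌝ ≡ v a
ev-⌜⌝ v (var x) = refl
ev-⌜⌝ v (box φ) = refl

ev-literal⁺ : ∀ {u v} a → u a ≡ v a → ev u (literal v a) ≡ true
ev-literal⁺ {u} {v} a e with v a
... | true  = trans (ev-⌜⌝ u a) e
... | false = neg-true⁺ (trans (ev-⌜⌝ u a) e)

ev-literal⁻ : ∀ {u v} a → ev u (literal v a) ≡ true → u a ≡ v a
ev-literal⁻ {u} {v} a e with v a
... | true  = trans (sym (ev-⌜⌝ u a)) e
... | false = trans (sym (ev-⌜⌝ u a)) (neg-true⁻ e)

ev-literals⁺ : ∀ {u v} L → (∀ {a} → a ∈ᴸ L → u a ≡ v a) → ev u (literals v L) ≡ true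
ev-literals⁺ {v = v} []      f = refl
ev-literals⁺ {v = v} (a ∷ L) f = &&-true⁺ (ev-literal⁺ {v = v} a (f (here refl))) (ev-literals⁺ L (f ∘ there))

ev-literals⁻ : ∀ {u v} L → ev u (literals v L) ≡ true → ∀ {a} → a ∈ᴸ L → u a ≡ v a
ev-literals⁻ {u} {v} (a ∷ L) e (here refl) = ev-literal⁻ {v = v} a (proj₁ (&&-true⁻ e))
ev-literals⁻ {u} {v} (a ∷ L) e (there b∈)  =
  ev-literals⁻ L (proj₂ (&&-true⁻ {ev u (literal v a)} e)) b∈

update : Atom → Bool → Assignment → Assignment
update a b v c = if does (c ≟ᵃ a) then b else v c

assignments : List Atom → List Assignment
assignments []      = (λ _ → false) ∷ []
assignments (a ∷ L) = cartesianProductWith (update a) (true ∷ false ∷ []) (assignments L)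

-- Up to agreement on L, assignments L lists all assignments.
assignments-complete : ∀ (u : Assignment) L → ∃[ v ] v ∈ᴸ assignments L × (∀ {a} → a ∈ᴸ L → u a ≡ v a)
assignments-complete u []      = _ , here refl , λ ()
assignments-complete u (a ∷ L) =
  let v , v∈ , f = assignments-complete u L
  in update a (u a) v , mem (u a) v∈ , agree v f
  where
  mem : ∀ b {v} → v ∈ᴸ assignments L → update a b v ∈ᴸ assignments (a ∷ L)
  mem true  v∈ = ∈-cartesianProductWith⁺ (update a) {true ∷ false ∷ []} (here refl) v∈
  mem false v∈ = ∈-cartesianProductWith⁺ (update a) {true ∷ false ∷ []} (there (here refl)) v∈
  agree : ∀ v → (∀ {c} → c ∈ᴸ L → u c ≡ v c) → ∀ {c} → c ∈ᴸ a ∷ L → u c ≡ update a (u a) v c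
  agree v f {c} c∈ with c ≟ᵃ a | c∈
  ... | yes refl | _         = refl
  ... | no c≢a   | here refl = ⊥-elim (c≢a refl)
  ... | no _     | there c∈L = f c∈L

-- `eval` treats ◇ φ as independent of □ ¬ φ, whereas `ev` does not. These are the instances of
-- `dual` that reconcile the two; nothing under a modality matters, since neither evaluation looks
-- there.
duals : Formula → List Formula
duals (φ `∧ ψ) = duals φ ++ duals ψ
duals (φ `∨ ψ) = duals φ ++ duals ψ
duals (φ `→ ψ) = duals φ ++ duals ψ
duals (◇ φ)    = (◇ φ `↔ `¬ (□ (`¬ φ))) ∷ []
duals _        = []

IsTrue : (Formula → Bool) → Formula → Set
IsTrue f φ = f φ ≡ true

iff-true⁻ : ∀ {a b} → (not a || b) && (not b || a) ≡ true → a ≡ b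
iff-true⁻ {true}  {true}  _ = refl
iff-true⁻ {false} {false} _ = refl

iff-true⁺ : ∀ {a b} → a ≡ b → (not a || b) && (not b || a) ≡ true
iff-true⁺ {true}  refl = refl
iff-true⁺ {false} refl = refl

eval-ev : ∀ {v} φ → Allᴸ (IsTrue (eval v)) (duals φ) → eval v φ ≡ ev (v ∘ ⌜_⌝) φ
eval-ev (var x)  d = refl
eval-ev `⊥       d = refl
eval-ev `⊤       d = refl
eval-ev (φ `∧ ψ) d = cong₂ _&&_ (eval-ev φ (++⁻ˡ (duals φ) d)) (eval-ev ψ (++⁻ʳ (duals φ) d))
eval-ev (φ `∨ ψ) d = cong₂ _||_ (eval-ev φ (++⁻ˡ (duals φ) d)) (eval-ev ψ (++⁻ʳ (duals φ) d))
eval-ev (φ `→ ψ) d = cong₂ (λ a b → not a || b) (eval-ev φ (++⁻ˡ (duals φ) d)) (eval-ev ψ (++⁻ʳ (duals φ) d))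
eval-ev (◇ φ)    (d ∷ᴬ []ᴬ) = iff-true⁻ d
eval-ev (□ φ)    d = refl

-- A record, unlike the Boolean equation, lets v and φ be inferred.
infix 3 _⊩_
record _⊩_ (v : Assignment) (φ : Formula) : Set where
  constructor forced
  field truth : ev v φ ≡ true
open _⊩_

⊩-→⁺ : ∀ {v φ ψ} → (v ⊩ φ → v ⊩ ψ) → v ⊩ φ `→ ψ
⊩-→⁺ f = forced (imp-true⁺ (truth ∘ f ∘ forced))

⊩-→⁻ : ∀ {v φ ψ} → v ⊩ φ `→ ψ → v ⊩ φ → v ⊩ ψ
⊩-→⁻ e e′ = forced (imp-true⁻ (truth e) (truth e′))

⊩-∧⁺ : ∀ {v φ ψ} → v ⊩ φ → v ⊩ ψ → v ⊩ φ `∧ ψ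
⊩-∧⁺ e e′ = forced (&&-true⁺ (truth e) (truth e′))

⊩-∧⁻ˡ : ∀ {v φ ψ} → v ⊩ φ `∧ ψ → v ⊩ φ
⊩-∧⁻ˡ e = forced (proj₁ (&&-true⁻ (truth e)))

⊩-∧⁻ʳ : ∀ {v φ ψ} → v ⊩ φ `∧ ψ → v ⊩ ψ
⊩-∧⁻ʳ {v} {φ} e = forced (proj₂ (&&-true⁻ {ev v φ} (truth e)))

module _ (Λ : Logic) where

  duals-derivable : ∀ φ → Allᴸ (Λ ⊢_) (duals φ)
  duals-derivable (var x)  = []ᴬ
  duals-derivable `⊥       = []ᴬ
  duals-derivable `⊤       = []ᴬ
  duals-derivable (φ `∧ ψ) = ++⁺ (duals-derivable φ) (duals-derivable ψ)
  duals-derivable (φ `∨ ψ) = ++⁺ (duals-derivable φ) (duals-derivable ψ)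
  duals-derivable (φ `→ ψ) = ++⁺ (duals-derivable φ) (duals-derivable ψ)
  duals-derivable (◇ φ)    = dual ∷ᴬ []ᴬ
  duals-derivable (□ φ)    = []ᴬ

  eval-consequence : ∀ {Γ φ} → Allᴸ (Λ ⊢_) Γ →
    (∀ v → Allᴸ (IsTrue (eval v)) Γ → eval v φ ≡ true) → Λ ⊢ φ
  eval-consequence []ᴬ       f = taut λ v → f v []ᴬ
  eval-consequence (d ∷ᴬ ds) f =
    mp (eval-consequence ds λ v es → imp-true⁺ λ e → f v (e ∷ᴬ es)) d

  -- Replaces Hilbert-style derivations by reasoning about an arbitrary assignment. The duality
  -- instances for φ are discharged once here, so that ◇ never needs separate treatment.
  consequence : ∀ {Γ φ} → Allᴸ (Λ ⊢_) Γ → (∀ {v} → Allᴸ (v ⊩_) Γ → v ⊩ φ) → Λ ⊢ φ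
  consequence {φ = φ} []ᴬ f = eval-consequence (duals-derivable φ) λ v es →
    trans (eval-ev φ es) (truth (f {v ∘ ⌜_⌝} []ᴬ))
  consequence (d ∷ᴬ ds) f = mp (consequence ds λ es → ⊩-→⁺ λ e → f (e ∷ᴬ es)) d

  □-imps : ∀ Γ {φ} → Λ ⊢ □ (imps Γ φ) `→ imps (map □ Γ) (□ φ)
  □-imps []      = consequence []ᴬ λ _ → ⊩-→⁺ id
  □-imps (ψ ∷ Γ) = consequence (dist ∷ᴬ □-imps Γ ∷ᴬ []ᴬ) λ { (e₁ ∷ᴬ e₂ ∷ᴬ []ᴬ) →
    ⊩-→⁺ λ e → ⊩-→⁺ λ e′ → ⊩-→⁻ e₂ (⊩-→⁻ (⊩-→⁻ e₁ e) e′) }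

  □-regular : ∀ Γ {φ} → Λ ⊢ imps Γ φ → Λ ⊢ imps (map □ Γ) (□ φ)
  □-regular Γ d = mp (□-imps Γ) (nec d)

löb : ∀ {φ} → GL ⊢ □ (□ φ `→ φ) `→ □ φ
löb {φ} = sub (λ _ → φ) (axiom {φ = □ (□ (var 0) `→ var 0) `→ □ (var 0)} refl)

-- Löb's axiom for φ ∧ □ φ.
GL-transitive : ∀ {φ} → GL ⊢ □ φ `→ □ (□ φ)
GL-transitive {φ} =
  consequence GL (□-regular GL (φ ∷ []) step ∷ᴬ löb {χ} ∷ᴬ □-regular GL (χ ∷ []) projʳ ∷ᴬ []ᴬ)
    λ { (e₁ ∷ᴬ e₂ ∷ᴬ e₃ ∷ᴬ []ᴬ) → ⊩-→⁺ λ e → ⊩-→⁻ e₃ (⊩-→⁻ e₂ (⊩-→⁻ e₁ e)) }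
  where
  χ = φ `∧ □ φ
  projˡ : GL ⊢ χ `→ φ
  projˡ = consequence GL []ᴬ λ _ → ⊩-→⁺ ⊩-∧⁻ˡ
  projʳ : GL ⊢ χ `→ □ φ
  projʳ = consequence GL []ᴬ λ _ → ⊩-→⁺ ⊩-∧⁻ʳ
  step : GL ⊢ φ `→ (□ χ `→ χ)
  step = consequence GL (□-regular GL (χ ∷ []) projˡ ∷ᴬ []ᴬ) λ { (e₁ ∷ᴬ []ᴬ) →
    ⊩-→⁺ λ e → ⊩-→⁺ λ e′ → ⊩-∧⁺ e (⊩-→⁻ e₁ e′) }

-- Finite tree models

-- Both logics use the same trees and differ only in the successor relation. Finiteness makes truth
-- computable.
data Tree : Set where
  node : (Var → Bool) → List Tree → Tree

label : Tree → Var → Bool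
label (node v _) = v

children : Tree → List Tree
children (node _ ts) = ts

-- everywhere Λ f t: f holds at all successors of t, that is, at its children
-- for K and at its proper descendants for GL.
everywhere  : Logic → (Tree → Bool) → Tree → Bool
everywhereᴸ : Logic → (Tree → Bool) → List Tree → Bool
below       : Logic → (Tree → Bool) → Tree → Bool
everywhere  Λ f (node v ts) = everywhereᴸ Λ f ts
everywhereᴸ Λ f []          = true
everywhereᴸ Λ f (t ∷ ts)    = below Λ f t && everywhereᴸ Λ f ts
below K     f t             = f t
below GL    f t             = f t && everywhere GL f t

data Succ : Logic → Tree → Tree → Set where
  child  : ∀ {Λ v ts t} → t ∈ᴸ ts → Succ Λ (node v ts) t
  deeper : ∀ {v ts t s} → t ∈ᴸ ts → Succ GL t s → Succ GL (node v ts) s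

below⇒ : ∀ Λ {f t} → below Λ f t ≡ true → f t ≡ true
below⇒ K  e = e
below⇒ GL e = proj₁ (&&-true⁻ e)

everywhereᴸ⁻ : ∀ {Λ f} ts → everywhereᴸ Λ f ts ≡ true → ∀ {t} → t ∈ᴸ ts → below Λ f t ≡ true
everywhereᴸ⁻ {Λ} {f} (t ∷ ts) e (here refl) = proj₁ (&&-true⁻ e)
everywhereᴸ⁻ {Λ} {f} (t ∷ ts) e (there s∈)  = everywhereᴸ⁻ ts (proj₂ (&&-true⁻ {below Λ f t} e)) s∈

everywhereᴸ⁺ : ∀ {Λ f} ts → (∀ {t} → t ∈ᴸ ts → below Λ f t ≡ true) → everywhereᴸ Λ f ts ≡ true
everywhereᴸ⁺ []       h = refl
everywhereᴸ⁺ (t ∷ ts) h = &&-true⁺ (h (here refl)) (everywhereᴸ⁺ ts (h ∘ there))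

everywhere-below : ∀ {Λ f t s} → everywhere Λ f t ≡ true → Succ Λ t s → below Λ f s ≡ true
everywhere-below e (child t∈)    = everywhereᴸ⁻ _ e t∈
everywhere-below {f = f} e (deeper {t = t} t∈ s) =
  everywhere-below {t = t} (proj₂ (&&-true⁻ {f t} (everywhereᴸ⁻ _ e t∈))) s

everywhere⁻ : ∀ {Λ f t s} → everywhere Λ f t ≡ true → Succ Λ t s → f s ≡ true
everywhere⁻ {Λ} {f} {t} {s} e r = below⇒ Λ {f} {s} (everywhere-below {f = f} {t} e r)

everywhere-false  : ∀ {Λ f} t → everywhere Λ f t ≡ false → ∃[ s ] Succ Λ t s × f s ≡ false
everywhereᴸ-false : ∀ {Λ f v ts} ss → (∀ {s} → s ∈ᴸ ss → s ∈ᴸ ts) → everywhereᴸ Λ f ss ≡ false →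
                    ∃[ s ] Succ Λ (node v ts) s × f s ≡ false
everywhere-false (node v ts) e = everywhereᴸ-false ts id e
everywhereᴸ-false {f = f} (s ∷ ss) inc e with f s in e₁
everywhereᴸ-false         (s ∷ ss) inc e | false = s , child (inc (here refl)) , e₁
everywhereᴸ-false {K}     (s ∷ ss) inc e | true  rewrite e₁ = everywhereᴸ-false ss (inc ∘ there) e
everywhereᴸ-false {GL} {f} (s ∷ ss) inc e | true rewrite e₁ with everywhere GL f s in e₂
... | true  = everywhereᴸ-false ss (inc ∘ there) e
... | false = let r , s≺r , e₃ = everywhere-false s e₂ in r , deeper (inc (here refl)) s≺r , e₃

everywhere⁺ : ∀ {Λ f} t → (∀ {s} → Succ Λ t s → f s ≡ true) → everywhere Λ f t ≡ true
everywhere⁺ {Λ} {f} t h with bool-split (everywhere Λ f t)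
... | inj₁ e = e
... | inj₂ e = let s , t≺s , fs = everywhere-false t e in true≢false (h t≺s) fs

Succ-trans : ∀ {t s r} → Succ GL t s → Succ GL s r → Succ GL t r
Succ-trans (child s∈)      s≺r = deeper s∈ s≺r
Succ-trans (deeper u∈ u≺s) s≺r = deeper u∈ (Succ-trans u≺s s≺r)

sat : Logic → Tree → Formula → Bool
sat Λ t (var x)  = label t x
sat Λ t `⊥       = false
sat Λ t `⊤       = true
sat Λ t (φ `∧ ψ) = sat Λ t φ && sat Λ t ψ
sat Λ t (φ `∨ ψ) = sat Λ t φ || sat Λ t ψ
sat Λ t (φ `→ ψ) = not (sat Λ t φ) || sat Λ t ψ
-- This is literally the value of ¬ □ ¬ φ, which makes soundness of `dual` hold by `refl`.
sat Λ t (◇ φ)    = not (everywhere Λ (λ s → not (sat Λ s φ) || false) t) || false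
sat Λ t (□ φ)    = everywhere Λ (λ s → sat Λ s φ) t

theory : Logic → Tree → Assignment
theory Λ t a = sat Λ t ⌜ a ⌝

sat-ev : ∀ {Λ t} φ → sat Λ t φ ≡ ev (theory Λ t) φ
sat-ev (var x)  = refl
sat-ev `⊥       = refl
sat-ev `⊤       = refl
sat-ev (φ `∧ ψ) = cong₂ _&&_ (sat-ev φ) (sat-ev ψ)
sat-ev (φ `∨ ψ) = cong₂ _||_ (sat-ev φ) (sat-ev ψ)
sat-ev (φ `→ ψ) = cong₂ (λ a b → not a || b) (sat-ev φ) (sat-ev ψ)
sat-ev (◇ φ)    = refl
sat-ev (□ φ)    = refl

sat-eval : ∀ {Λ t} φ → sat Λ t φ ≡ eval (sat Λ t) φ
sat-eval (var x)  = refl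
sat-eval `⊥       = refl
sat-eval `⊤       = refl
sat-eval (φ `∧ ψ) = cong₂ _&&_ (sat-eval φ) (sat-eval ψ)
sat-eval (φ `∨ ψ) = cong₂ _||_ (sat-eval φ) (sat-eval ψ)
sat-eval (φ `→ ψ) = cong₂ (λ a b → not a || b) (sat-eval φ) (sat-eval ψ)
sat-eval (◇ φ)    = refl
sat-eval (□ φ)    = refl

sat-◇⁺ : ∀ {Λ t s} φ → Succ Λ t s → sat Λ s φ ≡ true → sat Λ t (◇ φ) ≡ true
sat-◇⁺ {Λ} {t} {s} φ t≺s e = neg-true⁺ (≢true⇒≡false λ e′ →
  true≢false e (neg-true⁻ (everywhere⁻ {t = t} e′ t≺s)))

sat-◇⁻ : ∀ {Λ t} φ → sat Λ t (◇ φ) ≡ true → ∃[ s ] Succ Λ t s × sat Λ s φ ≡ true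
sat-◇⁻ {Λ} {t} φ e =
  let s , t≺s , e′ = everywhere-false t (neg-true⁻ e) in s , t≺s , neg-false⁻ e′

-- The counterpart of substitution on models. It serves the soundness of `sub` as well as the
-- readings of p as ⊥, as q and as p ∨ q.
relabel  : Logic → (Var → Formula) → Tree → Tree
relabelᴸ : Logic → (Var → Formula) → List Tree → List Tree
relabel  Λ σ (node v ts) = node (λ x → sat Λ (node v ts) (σ x)) (relabelᴸ Λ σ ts)
relabelᴸ Λ σ []          = []
relabelᴸ Λ σ (t ∷ ts)    = relabel Λ σ t ∷ relabelᴸ Λ σ ts

relabel-label : ∀ Λ σ t x → label (relabel Λ σ t) x ≡ sat Λ t (σ x)
relabel-label Λ σ (node v ts) x = refl

everywhere-relabel : ∀ Λ {f g} σ t → (∀ s → f s ≡ g (relabel Λ σ s)) →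
                     everywhere Λ f t ≡ everywhere Λ g (relabel Λ σ t)
everywhereᴸ-relabel : ∀ Λ {f g} σ ts → (∀ s → f s ≡ g (relabel Λ σ s)) →
                      everywhereᴸ Λ f ts ≡ everywhereᴸ Λ g (relabelᴸ Λ σ ts)
everywhere-relabel Λ σ (node v ts) h = everywhereᴸ-relabel Λ σ ts h
everywhereᴸ-relabel Λ  σ []       h = refl
everywhereᴸ-relabel K  σ (t ∷ ts) h = cong₂ _&&_ (h t) (everywhereᴸ-relabel K σ ts h)
everywhereᴸ-relabel GL σ (t ∷ ts) h =
  cong₂ _&&_ (cong₂ _&&_ (h t) (everywhere-relabel GL σ t h)) (everywhereᴸ-relabel GL σ ts h)

sat-substitute : ∀ {Λ σ} t φ → sat Λ t (substitute σ φ) ≡ sat Λ (relabel Λ σ t) φ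
sat-substitute {Λ} {σ} t (var x)  = sym (relabel-label Λ σ t x)
sat-substitute t `⊥       = refl
sat-substitute t `⊤       = refl
sat-substitute t (φ `∧ ψ) = cong₂ _&&_ (sat-substitute t φ) (sat-substitute t ψ)
sat-substitute t (φ `∨ ψ) = cong₂ _||_ (sat-substitute t φ) (sat-substitute t ψ)
sat-substitute t (φ `→ ψ) = cong₂ (λ a b → not a || b) (sat-substitute t φ) (sat-substitute t ψ)
sat-substitute {Λ} {σ} t (◇ φ) = cong (λ a → not a || false)
  (everywhere-relabel Λ σ t λ s → cong (λ a → not a || false) (sat-substitute s φ))
sat-substitute {Λ} {σ} t (□ φ) = everywhere-relabel Λ σ t λ s → sat-substitute s φ

-- Induction on the tree: the premise is inherited by each child, so □ φ holds at the child, and the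
-- implication assumed there gives φ.
sat-löb : ∀ t φ → sat GL t (□ (□ φ `→ φ)) ≡ true → sat GL t (□ φ) ≡ true
sat-löb (node v ts) φ e = go ts e
  where
  go : ∀ ts → everywhereᴸ GL (λ s → sat GL s (□ φ `→ φ)) ts ≡ true →
       everywhereᴸ GL (λ s → sat GL s φ) ts ≡ true
  go []       e = refl
  go (t ∷ ts) e =
    let e₁ , e₂ = &&-true⁻ e
        e₃ , e₄ = &&-true⁻ {sat GL t (□ φ `→ φ)} e₁
        e₅ = sat-löb t φ e₄
    in &&-true⁺ (&&-true⁺ (imp-true⁻ e₃ e₅) e₅) (go ts e₂)

sound : ∀ {Λ φ} → Λ ⊢ φ → ∀ t → sat Λ t φ ≡ true
sound {K} (axiom ())
sound {GL} (axiom refl) t = imp-true⁺ (sat-löb t (var 0))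
sound (taut {φ} f) t = trans (sat-eval φ) (f _)
sound (dist {φ} {ψ}) t = imp-true⁺ λ e → imp-true⁺ λ e′ → everywhere⁺ t λ t≺s →
  imp-true⁻ (everywhere⁻ {t = t} e t≺s) (everywhere⁻ {t = t} e′ t≺s)
sound {Λ} (dual {φ}) t = iff-true⁺ {sat Λ t (◇ φ)} refl
sound (mp d e) t = imp-true⁻ (sound d t) (sound e t)
sound (nec d) t = everywhere⁺ t λ {s} _ → sound d s
sound (sub {φ} σ d) t = trans (sat-substitute t φ) (sound d (relabel _ σ t))

-- Completeness

⊩-imps⁺ : ∀ {v} Γ {φ} → ((∀ {ψ} → ψ ∈ᴸ Γ → v ⊩ ψ) → v ⊩ φ) → v ⊩ imps Γ φ
⊩-imps⁺ Γ h = forced (ev-imps⁺ Γ λ f → truth (h (forced ∘ f)))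

⊩-imps⁻ : ∀ {v} Γ {φ} → v ⊩ imps Γ φ → (∀ {ψ} → ψ ∈ᴸ Γ → v ⊩ ψ) → v ⊩ φ
⊩-imps⁻ Γ e h = forced (ev-imps⁻ Γ (truth e) (truth ∘ h))

trues : Assignment → List Atom → List Formula
trues v []          = []
trues v (var x ∷ L) = trues v L
trues v (box φ ∷ L) = if v (box φ) then φ ∷ trues v L else trues v L

∈-trues⁺ : ∀ {v φ} L → box φ ∈ᴸ L → v (box φ) ≡ true → φ ∈ᴸ trues v L
∈-trues⁺ (box φ ∷ L) (here refl) e rewrite e = here refl
∈-trues⁺ (var x ∷ L) (there φ∈)  e = ∈-trues⁺ L φ∈ e
∈-trues⁺ {v} (box ψ ∷ L) (there φ∈) e with v (box ψ)
... | true  = there (∈-trues⁺ L φ∈ e)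
... | false = ∈-trues⁺ L φ∈ e

∈-trues⁻ : ∀ {v φ} L → φ ∈ᴸ trues v L → box φ ∈ᴸ L × v (box φ) ≡ true
∈-trues⁻ (var x ∷ L) φ∈ = let m , e = ∈-trues⁻ L φ∈ in there m , e
∈-trues⁻ {v} (box ψ ∷ L) φ∈ with v (box ψ) in e | φ∈
... | true  | here refl = here refl , e
... | true  | there φ∈′ = let m , e = ∈-trues⁻ L φ∈′ in there m , e
... | false | φ∈′       = let m , e = ∈-trues⁻ L φ∈′ in there m , e

-- demand Λ Γ φ is refuted exactly by the possible successors, where φ fails,
-- of a world satisfying □ ψ for all ψ ∈ Γ; for GL, φ may be taken to fail at
-- that successor for the last time.
demand : Logic → List Formula → Formula → Formula
demand K  Γ φ = imps Γ φ
demand GL Γ φ = imps Γ (imps (map □ Γ) (□ φ `→ φ))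

-- For GL, boxing the demand asks for □ □ ψ as well as □ ψ, which transitivity supplies; what
-- remains is □ (□ φ → φ), and Löb's axiom turns it into □ φ.
demand-□ : ∀ Λ Γ φ → Λ ⊢ demand Λ Γ φ → Λ ⊢ imps (map □ Γ) (□ φ)
demand-□ K  Γ φ d = □-regular K Γ d
demand-□ GL Γ φ d = consequence GL
  (□-regular GL Γ d ∷ᴬ □-imps GL (map □ Γ) ∷ᴬ löb {φ} ∷ᴬ tabulate four)
  λ { {v} (e₁ ∷ᴬ e₂ ∷ᴬ e₃ ∷ᴬ es) → ⊩-imps⁺ (map □ Γ) λ h →
      ⊩-→⁻ e₃ (⊩-imps⁻ (map □ (map □ Γ)) (⊩-→⁻ e₂ (⊩-imps⁻ (map □ Γ) e₁ h)) (twice es h)) }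
  where
  transitivity : Formula → Formula
  transitivity ψ = □ ψ `→ □ (□ ψ)
  four : ∀ {χ} → χ ∈ᴸ map transitivity Γ → GL ⊢ χ
  four χ∈ with _ , _ , refl ← ∈-map⁻ transitivity χ∈ = GL-transitive
  twice : ∀ {v} → Allᴸ (v ⊩_) (map transitivity Γ) → (∀ {ψ} → ψ ∈ᴸ map □ Γ → v ⊩ ψ) →
          ∀ {ψ} → ψ ∈ᴸ map □ (map □ Γ) → v ⊩ ψ
  twice es h ψ∈ with _ , □χ∈ , refl ← ∈-map⁻ □ ψ∈ with _ , χ∈ , refl ← ∈-map⁻ □ □χ∈ =
    ⊩-→⁻ (lookup es (∈-map⁺ transitivity χ∈)) (h □χ∈)

Realizes : Logic → Tree → Assignment → List Atom → Set
Realizes Λ t v L = ∀ {a} → a ∈ᴸ L → theory Λ t a ≡ v a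

module _ (Λ : Logic) where

  -- A derivable demand forces □ φ to be true in every assignment that agrees with v on L, against v
  -- itself.
  refute : ∀ v L φ → box φ ∈ᴸ L → v (box φ) ≡ false →
           Λ ⊢ demand Λ (trues v L) φ → Λ ⊢ `¬ (literals v L)
  refute v L φ φ∈ e d = consequence Λ (demand-□ Λ (trues v L) φ d ∷ᴬ []ᴬ) λ { {u} (e₁ ∷ᴬ []ᴬ) →
    ⊩-→⁺ λ e₂ → let agree = λ {a} → ev-literals⁻ {u} {v} L (truth e₂) {a} in
      true≢false
        (truth (⊩-imps⁻ (map □ (trues v L)) e₁ λ ψ∈ → boxed agree ψ∈))
        (trans (agree φ∈) e) }
    where
    boxed : ∀ {u} → (∀ {a} → a ∈ᴸ L → u a ≡ v a) → ∀ {ψ} → ψ ∈ᴸ map □ (trues v L) → u ⊩ ψ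
    boxed agree ψ∈ with χ , χ∈ , refl ← ∈-map⁻ □ ψ∈ =
      let m , e = ∈-trues⁻ L χ∈ in forced (trans (agree m) e)

demand-false : ∀ Λ {t} Γ φ → sat Λ t (demand Λ Γ φ) ≡ false →
  (∀ {ψ} → ψ ∈ᴸ Γ → below Λ (λ s → sat Λ s ψ) t ≡ true) × sat Λ t φ ≡ false
demand-false K  {t} Γ φ e =
  let h , e₁ = ev-imps-false⁻ Γ (trans (sym (sat-ev {K} {t} (imps Γ φ))) e)
  in (λ {ψ} ψ∈ → trans (sat-ev ψ) (h ψ∈)) , trans (sat-ev φ) e₁
demand-false GL {t} Γ φ e =
  let h₁ , e₁ = ev-imps-false⁻ Γ (trans (sym (sat-ev {GL} {t} (demand GL Γ φ))) e)
      h₂ , e₂ = ev-imps-false⁻ (map □ Γ) e₁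
  in (λ {ψ} ψ∈ → &&-true⁺ (trans (sat-ev ψ) (h₁ ψ∈)) (h₂ (∈-map⁺ □ ψ∈))) ,
     trans (sat-ev φ) (proj₂ (imp-false⁻ {theory GL t (box φ)} e₂))

Refutable : Logic → Formula → Set
Refutable Λ φ = ∃[ t ] sat Λ t φ ≡ false

module _ (Λ : Logic) where

  -- The root receives one child per false box of L: the tree refuting its demand. True boxes
  -- survive because each demand has their bodies, and for GL also the boxes themselves, among its
  -- premises.
  realize : ∀ v L →
    (∀ {φ} → box φ ∈ᴸ L → v (box φ) ≡ false → Refutable Λ (demand Λ (trues v L) φ)) →
    ∃[ t ] Realizes Λ t v L
  realize v L witness = node (v ∘ var) ts , λ {a} → correct a
    where
    Admissible : Tree → Set
    Admissible t = ∀ {ψ} → ψ ∈ᴸ trues v L → below Λ (λ s → sat Λ s ψ) t ≡ true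
    collect : ∀ M → (∀ {a} → a ∈ᴸ M → a ∈ᴸ L) → ∃[ ts ] (∀ {t} → t ∈ᴸ ts → Admissible t) ×
      (∀ {φ} → box φ ∈ᴸ M → v (box φ) ≡ false → ∃[ t ] t ∈ᴸ ts × sat Λ t φ ≡ false)
    collect []          inc = [] , (λ ()) , λ ()
    collect (var x ∷ M) inc = let ts , f , g = collect M (inc ∘ there) in
      ts , f , λ { (there m) e → g m e }
    collect (box φ ∷ M) inc with bool-split (v (box φ)) | collect M (inc ∘ there)
    ... | inj₁ e | ts , f , g = ts , f , λ { (here refl) e′ → true≢false e e′ ; (there m) e′ → g m e′ }
    ... | inj₂ e | ts , f , g =
      let t , e₁ = witness (inc (here refl)) e
          h , e₂ = demand-false Λ (trues v L) φ e₁
      in t ∷ ts , (λ { (here refl) → h ; (there m) → f m }) ,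
         λ { (here refl) _ → t , here refl , e₂
           ; (there m) e′ → let s , s∈ , e₃ = g m e′ in s , there s∈ , e₃ }
    ts = proj₁ (collect L id)
    correct : ∀ a → a ∈ᴸ L → theory Λ (node (v ∘ var) ts) a ≡ v a
    correct (var x) a∈ = refl
    correct (box φ) a∈ with bool-split (v (box φ))
    ... | inj₁ e =
      trans (everywhereᴸ⁺ ts λ {t} t∈ → proj₁ (proj₂ (collect L id)) t∈ (∈-trues⁺ L a∈ e)) (sym e)
    ... | inj₂ e =
      let t , t∈ , e₁ = proj₂ (proj₂ (collect L id)) a∈ e in
      trans (≢true⇒≡false λ e₂ → true≢false (below⇒ Λ (everywhereᴸ⁻ ts e₂ t∈)) e₁) (sym e)

  decide-literals : ∀ v L →
    (∀ {φ} → box φ ∈ᴸ L → v (box φ) ≡ false →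
       Λ ⊢ demand Λ (trues v L) φ ⊎ Refutable Λ (demand Λ (trues v L) φ)) →
    Λ ⊢ `¬ (literals v L) ⊎ (∃[ t ] Realizes Λ t v L)
  decide-literals v L f = conclude (search L λ {a} → test a)
    where
    Witnessed Contradictory : Atom → Set
    Witnessed (var _) = ⊤
    Witnessed (box φ) = v (box φ) ≡ false → Refutable Λ (demand Λ (trues v L) φ)
    Contradictory (var _) = ⊥
    Contradictory (box φ) = v (box φ) ≡ false × Λ ⊢ demand Λ (trues v L) φ
    test : ∀ a → a ∈ᴸ L → Witnessed a ⊎ Contradictory a
    test (var _) _  = inj₁ tt
    test (box φ) φ∈ with bool-split (v (box φ))
    ... | inj₁ e = inj₁ λ e′ → true≢false e e′
    ... | inj₂ e with f φ∈ e
    ...   | inj₁ d = inj₂ (e , d)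
    ...   | inj₂ r = inj₁ λ _ → r
    conclude : (∀ {a} → a ∈ᴸ L → Witnessed a) ⊎ (∃[ a ] a ∈ᴸ L × Contradictory a) →
               Λ ⊢ `¬ (literals v L) ⊎ (∃[ t ] Realizes Λ t v L)
    conclude (inj₁ g)                    = inj₂ (realize v L λ φ∈ → g φ∈)
    conclude (inj₂ (box φ , φ∈ , e , d)) = inj₁ (refute Λ v L φ φ∈ e d)

  -- Takes the place of Lindenbaum's lemma: the finitely many assignments on L act as maximal sets.
  -- If each one falsifying φ is refuted by a derivation, φ follows from the case distinction over
  -- all of them.
  decide-via : ∀ φ L → atoms φ ⊆ᴬ L →
    (∀ v → ev v φ ≡ false → Λ ⊢ `¬ (literals v L) ⊎ (∃[ t ] Realizes Λ t v L)) →
    Λ ⊢ φ ⊎ Refutable Λ φ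
  decide-via φ L inc f = conclude (search (assignments L) λ {v} _ → test v)
    where
    premise : Assignment → Formula
    premise v = literals v L `→ φ
    test : ∀ v → Λ ⊢ premise v ⊎ Refutable Λ φ
    test v with bool-split (ev v φ)
    ... | inj₁ e = inj₁ (consequence Λ []ᴬ λ {u} _ → ⊩-→⁺ λ e′ → forced
            (trans (ev-cong {u} {v} φ λ a∈ → ev-literals⁻ {u} {v} L (truth e′) (inc a∈)) e))
    ... | inj₂ e with f v e
    ...   | inj₁ d = inj₁ (consequence Λ (d ∷ᴬ []ᴬ) λ { (e₁ ∷ᴬ []ᴬ) →
              ⊩-→⁺ λ e₂ → ex-falso (⊩-→⁻ e₁ e₂) })
            where
            ex-falso : ∀ {u} → u ⊩ `⊥ → u ⊩ φ
            ex-falso (forced ())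
    ...   | inj₂ (t , r) = inj₂ (t , trans (sat-ev φ) (trans (ev-cong φ λ a∈ → r (inc a∈)) e))
    conclude : (∀ {v} → v ∈ᴸ assignments L → Λ ⊢ premise v) ⊎
               (∃[ v ] v ∈ᴸ assignments L × Refutable Λ φ) → Λ ⊢ φ ⊎ Refutable Λ φ
    conclude (inj₂ (_ , _ , r)) = inj₂ r
    conclude (inj₁ g)           = inj₁ (consequence Λ (tabulate derivable) λ {u} es →
      let v , v∈ , agree = assignments-complete u L in
      ⊩-→⁻ (lookup es (∈-map⁺ premise v∈)) (forced (ev-literals⁺ {u} {v} L agree)))
      where
      derivable : ∀ {ψ} → ψ ∈ᴸ map premise (assignments L) → Λ ⊢ ψ
      derivable ψ∈ with v , v∈ , refl ← ∈-map⁻ premise ψ∈ = g v∈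

-- Modal depth bounds the recursion for K, the number of false boxes that for GL.
depth : Formula → ℕ
depth (var x)  = 0
depth `⊥       = 0
depth `⊤       = 0
depth (φ `∧ ψ) = depth φ ⊔ depth ψ
depth (φ `∨ ψ) = depth φ ⊔ depth ψ
depth (φ `→ ψ) = depth φ ⊔ depth ψ
depth (◇ φ)    = suc (depth φ)
depth (□ φ)    = suc (depth φ)

depth-atom : ∀ φ {ψ} → box ψ ∈ᴸ atoms φ → suc (depth ψ) ≤ depth φ
depth-atom-⊔ : ∀ φ χ {ψ} → box ψ ∈ᴸ atoms φ ++ atoms χ → suc (depth ψ) ≤ depth φ ⊔ depth χ
depth-atom-⊔ φ χ ψ∈ with ∈-++⁻ (atoms φ) ψ∈
... | inj₁ m = ≤-trans (depth-atom φ m) (m≤m⊔n _ _)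
... | inj₂ m = ≤-trans (depth-atom χ m) (m≤n⊔m _ _)
depth-atom (var x)  (here ())
depth-atom (var x)  (there ())
depth-atom (φ `∧ χ) ψ∈ = depth-atom-⊔ φ χ ψ∈
depth-atom (φ `∨ χ) ψ∈ = depth-atom-⊔ φ χ ψ∈
depth-atom (φ `→ χ) ψ∈ = depth-atom-⊔ φ χ ψ∈
depth-atom (◇ φ) (here refl) = s≤s (⊔-lub ≤-refl z≤n)
depth-atom (◇ φ) (there ψ∈)  = m≤n⇒m≤1+n (depth-atom φ ψ∈)
depth-atom (□ φ) (here refl) = ≤-refl
depth-atom (□ φ) (there ψ∈)  = m≤n⇒m≤1+n (depth-atom φ ψ∈)

depth-imps : ∀ {n} Γ {φ} → (∀ {ψ} → ψ ∈ᴸ Γ → depth ψ ≤ n) → depth φ ≤ n → depth (imps Γ φ) ≤ n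
depth-imps []      f le = le
depth-imps (ψ ∷ Γ) f le = ⊔-lub (f (here refl)) (depth-imps Γ (f ∘ there) le)

decide-K : ∀ n φ → depth φ ≤ n → K ⊢ φ ⊎ Refutable K φ
decide-K n φ le = decide-via K φ (atoms φ) id λ v _ → decide-literals K v (atoms φ) λ {ψ} ψ∈ _ →
  smaller n (≤-trans (depth-atom φ ψ∈) le) λ χ∈ →
    ≤-trans (depth-atom φ (proj₁ (∈-trues⁻ {v} (atoms φ) χ∈))) le
  where
  -- Having a box in φ makes the bound positive; the bodies of the boxes fit its predecessor.
  smaller : ∀ n {Γ ψ} → suc (depth ψ) ≤ n → (∀ {χ} → χ ∈ᴸ Γ → suc (depth χ) ≤ n) →
            K ⊢ imps Γ ψ ⊎ Refutable K (imps Γ ψ)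
  smaller (suc n) {Γ} {ψ} (s≤s le) f = decide-K n (imps Γ ψ) (depth-imps Γ (λ χ∈ → ≤-pred (f χ∈)) le)

count : Assignment → List Atom → ℕ
count v []      = 0
count v (a ∷ L) = if v a then suc (count v L) else count v L

count-≤-length : ∀ v L → count v L ≤ length L
count-≤-length v [] = z≤n
count-≤-length v (a ∷ L) with v a
... | true  = s≤s (count-≤-length v L)
... | false = m≤n⇒m≤1+n (count-≤-length v L)

count-≤ : ∀ {u v} L → (∀ {a} → a ∈ᴸ L → u a ≡ true → v a ≡ true) → count u L ≤ count v L
count-≤ [] f = z≤n
count-≤ {u} {v} (a ∷ L) f with u a in e₁ | v a in e₂ | count-≤ {u} {v} L (f ∘ there)
... | true  | true  | le = s≤s le
... | true  | false | le = true≢false (f (here refl) e₁) e₂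
... | false | true  | le = m≤n⇒m≤1+n le
... | false | false | le = le

count-< : ∀ {u v a} L → (∀ {a} → a ∈ᴸ L → u a ≡ true → v a ≡ true) →
          a ∈ᴸ L → u a ≡ false → v a ≡ true → count u L < count v L
count-< {u} {v} (a ∷ L) f (here refl) e₁ e₂ rewrite e₁ | e₂ = s≤s (count-≤ L (f ∘ there))
count-< {u} {v} (b ∷ L) f (there a∈)  e₁ e₂
  with u b in e₃ | v b in e₄ | count-< {u} {v} L (f ∘ there) a∈ e₁ e₂
... | true  | true  | lt = s≤s lt
... | true  | false | lt = true≢false (f (here refl) e₃) e₄
... | false | true  | lt = m≤n⇒m≤1+n lt
... | false | false | lt = lt

false-box : Assignment → Assignment
false-box v (var x) = false
false-box v (box φ) = not (v (box φ))

not-true : ∀ {a} → not a ≡ true → a ≡ false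
not-true {false} _ = refl

++-⊆ : ∀ {xs ys zs : List Atom} → xs ⊆ᴬ zs → ys ⊆ᴬ zs → xs ++ ys ⊆ᴬ zs
++-⊆ {xs} f g a∈ with ∈-++⁻ xs a∈
... | inj₁ m = f m
... | inj₂ m = g m

atoms-imps : ∀ {L} Γ {φ} → (∀ {ψ} → ψ ∈ᴸ Γ → atoms ψ ⊆ᴬ L) → atoms φ ⊆ᴬ L → atoms (imps Γ φ) ⊆ᴬ L
atoms-imps []      f g = g
atoms-imps (ψ ∷ Γ) f g = ++-⊆ (f (here refl)) (atoms-imps Γ (f ∘ there) g)

∷-⊆ : ∀ {a : Atom} {xs ys} → a ∈ᴸ ys → xs ⊆ᴬ ys → a ∷ xs ⊆ᴬ ys
∷-⊆ a∈ f (here refl) = a∈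
∷-⊆ a∈ f (there b∈)  = f b∈

module _ (L : List Atom) (closed : Closed L) where

  demand-atoms : ∀ v {φ} → box φ ∈ᴸ L → atoms (demand GL (trues v L) φ) ⊆ᴬ L
  demand-atoms v φ∈ = atoms-imps (trues v L)
    (λ ψ∈ → closed (proj₁ (∈-trues⁻ L ψ∈)))
    (atoms-imps (map □ (trues v L)) boxes
      (++-⊆ (∷-⊆ φ∈ (closed φ∈)) (closed φ∈)))
    where
    boxes : ∀ {ψ} → ψ ∈ᴸ map □ (trues v L) → atoms ψ ⊆ᴬ L
    boxes ψ∈ with χ , χ∈ , refl ← ∈-map⁻ □ ψ∈ =
      let m = proj₁ (∈-trues⁻ L χ∈) in ∷-⊆ m (closed m)

  -- Depth would not decrease, as a GL demand contains the boxes themselves. But its premises keep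
  -- the boxes true in v true in u, and refuting □ φ → φ adds □ φ to them.
  demand-count : ∀ u v φ → box φ ∈ᴸ L → v (box φ) ≡ false → ev u (demand GL (trues v L) φ) ≡ false →
                 count (false-box u) L < count (false-box v) L
  demand-count u v φ φ∈ e e₀ = count-< L (λ {a} → persists a) φ∈ (cong not (proj₁ e₃)) (cong not e)
    where
    e₁ = ev-imps-false⁻ {u} (trues v L) e₀
    e₂ = ev-imps-false⁻ {u} (map □ (trues v L)) (proj₂ e₁)
    e₃ = imp-false⁻ {u (box φ)} (proj₂ e₂)
    persists : ∀ a → a ∈ᴸ L → false-box u a ≡ true → false-box v a ≡ true
    persists (var x) a∈ ()
    persists (box ψ) a∈ e₄ = cong not (≢true⇒≡false λ e₅ →
      true≢false (proj₁ e₂ (∈-map⁺ □ (∈-trues⁺ L a∈ e₅))) (not-true e₄))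

  decide-literals-GL : ∀ n v → count (false-box v) L < n →
    GL ⊢ `¬ (literals v L) ⊎ (∃[ t ] Realizes GL t v L)
  decide-literals-GL (suc n) v (s≤s le) = decide-literals GL v L λ {φ} φ∈ e →
    decide-via GL _ L (demand-atoms v φ∈) λ u e₀ →
      decide-literals-GL n u (≤-trans (demand-count u v φ φ∈ e e₀) le)

decide : ∀ Λ φ → Λ ⊢ φ ⊎ Refutable Λ φ
decide K  φ = decide-K (depth φ) φ ≤-refl
decide GL φ = decide-via GL φ (atoms φ) id λ v _ → decide-literals-GL (atoms φ) (atoms-closed φ) _ v ≤-refl

complete : ∀ {Λ φ} → (∀ t → sat Λ t φ ≡ true) → Λ ⊢ φ
complete {Λ} {φ} f with decide Λ φ
... | inj₁ d       = d
... | inj₂ (t , e) = true≢false (f t) e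

-- Needed to select the summands of the normal form.
derivable? : ∀ Λ φ → Dec (Λ ⊢ φ)
derivable? Λ φ with decide Λ φ
... | inj₁ d       = yes d
... | inj₂ (t , e) = no λ d → true≢false (sound d t) e

-- Sufficiency: δ-formulas distribute over disjunction

if-self : ∀ {A : Set} {a b : A} x → (if does (x ≟ x) then a else b) ≡ a
if-self x rewrite dec-true (x ≟ x) refl = refl

if-other : ∀ {A : Set} {a b : A} {x y} → x ≢ y → (if does (x ≟ y) then a else b) ≡ b
if-other {x = x} {y} x≢y rewrite dec-false (x ≟ y) x≢y = refl

substitute-fresh : ∀ {n} {r : Vec Var n} {p χ} → p ∉ r → ∀ φ → φ ∈Fm[ r ] → φ [ p ≔ χ ] ≡ φ
substitute-fresh p∉r (var x)  x∈        = if-other {x = x} λ { refl → p∉r x∈ }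
substitute-fresh p∉r `⊥       _         = refl
substitute-fresh p∉r `⊤       _         = refl
substitute-fresh p∉r (φ `∧ ψ) (φ∈ , ψ∈) = cong₂ _`∧_ (substitute-fresh p∉r φ φ∈) (substitute-fresh p∉r ψ ψ∈)
substitute-fresh p∉r (φ `∨ ψ) (φ∈ , ψ∈) = cong₂ _`∨_ (substitute-fresh p∉r φ φ∈) (substitute-fresh p∉r ψ ψ∈)
substitute-fresh p∉r (φ `→ ψ) (φ∈ , ψ∈) = cong₂ _`→_ (substitute-fresh p∉r φ φ∈) (substitute-fresh p∉r ψ ψ∈)
substitute-fresh p∉r (◇ φ)    φ∈        = cong ◇ (substitute-fresh p∉r φ φ∈)
substitute-fresh p∉r (□ φ)    φ∈        = cong □ (substitute-fresh p∉r φ φ∈)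

SemanticallyAdditive : Logic → (p q : Var) → Formula → Set
SemanticallyAdditive Λ p q φ =
  ∀ t → sat Λ t (φ [ p ≔ var p `∨ var q ]) ≡ sat Λ t φ || sat Λ t (φ [ p ≔ var q ])

additive⁺ : ∀ {Λ p q φ} → SemanticallyAdditive Λ p q φ → Additive Λ p q φ
additive⁺ h = complete λ t → iff-true⁺ (h t)

additive⁻ : ∀ {Λ p q φ} → Additive Λ p q φ → SemanticallyAdditive Λ p q φ
additive⁻ d t = iff-true⁻ (sound d t)

equivalent-sat : ∀ {Λ φ ψ} → Equivalent Λ φ ψ → ∀ t → sat Λ t φ ≡ sat Λ t ψ
equivalent-sat d t = iff-true⁻ (sound d t)

||-interchange : ∀ a b c d → (a || b) || (c || d) ≡ (a || c) || (b || d)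
||-interchange true  b     c     d = refl
||-interchange false true  true  d = refl
||-interchange false true  false d = refl
||-interchange false false c     d = refl

module _ {Λ : Logic} {p q : Var} where

  -- An equivalence holds at all trees, in particular at the relabelled one that interprets the
  -- substitution.
  additive-cong : ∀ {φ ψ} → Equivalent Λ φ ψ → SemanticallyAdditive Λ p q ψ → SemanticallyAdditive Λ p q φ
  additive-cong {φ} {ψ} d h t =
    trans (substituted _) (trans (h t) (sym (cong₂ _||_ (equivalent-sat d t) (substituted _))))
    where
    substituted : ∀ χ → sat Λ t (φ [ p ≔ χ ]) ≡ sat Λ t (ψ [ p ≔ χ ])
    substituted χ = trans (sat-substitute t φ)
      (trans (equivalent-sat d (relabel Λ _ t)) (sym (sat-substitute t ψ)))

  additive-◇ : ∀ φ → SemanticallyAdditive Λ p q φ → SemanticallyAdditive Λ p q (◇ φ)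
  additive-◇ φ h t = true-ext to from
    where
    φ∨ = φ [ p ≔ var p `∨ var q ]
    φq = φ [ p ≔ var q ]
    to : sat Λ t (◇ φ∨) ≡ true → sat Λ t (◇ φ) || sat Λ t (◇ φq) ≡ true
    to e with s , t≺s , e₁ ← sat-◇⁻ {Λ} {t} φ∨ e
         with ||-true⁻ {sat Λ s φ} (trans (sym (h s)) e₁)
    ... | inj₁ e₂ = ||-true⁺ˡ (sat-◇⁺ {Λ} {t} φ t≺s e₂)
    ... | inj₂ e₂ = ||-true⁺ʳ {sat Λ t (◇ φ)} (sat-◇⁺ {Λ} {t} φq t≺s e₂)
    from : sat Λ t (◇ φ) || sat Λ t (◇ φq) ≡ true → sat Λ t (◇ φ∨) ≡ true
    from e with ||-true⁻ {sat Λ t (◇ φ)} e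
    ... | inj₁ e₁ = let s , t≺s , e₂ = sat-◇⁻ {Λ} {t} φ e₁ in
                    sat-◇⁺ {Λ} {t} φ∨ t≺s (trans (h s) (||-true⁺ˡ e₂))
    ... | inj₂ e₁ = let s , t≺s , e₂ = sat-◇⁻ {Λ} {t} φq e₁ in
                    sat-◇⁺ {Λ} {t} φ∨ t≺s (trans (h s) (||-true⁺ʳ {sat Λ s φ} e₂))

  additive-∨ : ∀ φ ψ → SemanticallyAdditive Λ p q φ → SemanticallyAdditive Λ p q ψ →
               SemanticallyAdditive Λ p q (φ `∨ ψ)
  additive-∨ φ ψ g h t = trans (cong₂ _||_ (g t) (h t))
    (||-interchange (sat Λ t φ) _ (sat Λ t ψ) _)

  module _ {n} {r : Vec Var n} (p∉r : p ∉ r) where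

    additive-constant : ∀ ϰ → ϰ ∈Fm[ r ] → SemanticallyAdditive Λ p q ϰ
    additive-constant ϰ ϰ∈ t
      rewrite substitute-fresh {χ = var p `∨ var q} p∉r ϰ ϰ∈ | substitute-fresh {χ = var q} p∉r ϰ ϰ∈
      = sym (∨-idem _)

    additive-∧ : ∀ ϰ φ → ϰ ∈Fm[ r ] → SemanticallyAdditive Λ p q φ → SemanticallyAdditive Λ p q (ϰ `∧ φ)
    additive-∧ ϰ φ ϰ∈ h t
      rewrite substitute-fresh {χ = var p `∨ var q} p∉r ϰ ϰ∈ | substitute-fresh {χ = var q} p∉r ϰ ϰ∈ | h t
      = ∧-distribˡ-∨ (sat Λ t ϰ) _ _

    additive-δ : ∀ {m} (ϰs : Vec Formula (suc m)) → All (_∈Fm[ r ]) ϰs → SemanticallyAdditive Λ p q (δ p ϰs)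
    additive-δ (ϰ ∷ [])          (ϰ∈ ∷ [])  = additive-∧ ϰ (var p) ϰ∈ λ t →
      trans (cong (sat Λ t) (if-self p)) (cong (λ χ → label t p || sat Λ t χ) (sym (if-self p)))
    additive-δ (ϰ ∷ ϰs@(_ ∷ _)) (ϰ∈ ∷ ϰs∈) =
      additive-∧ ϰ (◇ (δ p ϰs)) ϰ∈ (additive-◇ (δ p ϰs) (additive-δ ϰs ϰs∈))

    additive-⋁ : ∀ {Δ₀} → Allᴸ (Δ p r) Δ₀ → SemanticallyAdditive Λ p q (⋁ Δ₀)
    additive-⋁ []ᴬ t = refl
    additive-⋁ {_ ∷ Δ₀} ((_ , ϰs , ϰs∈ , refl) ∷ᴬ ds) =
      additive-∨ (δ p ϰs) (⋁ Δ₀) (additive-δ ϰs ϰs∈) (additive-⋁ ds)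

    additive-A₀ : ∀ {ψ} → A₀ p r ψ → SemanticallyAdditive Λ p q ψ
    additive-A₀ (Δ₀ , ϰ , ds , ϰ∈ , refl) = additive-∨ (⋁ Δ₀) ϰ (additive-⋁ ds) (additive-constant ϰ ϰ∈)

-- Necessity

below-cong : ∀ Λ {f t s} → f t ≡ f s → everywhere Λ f t ≡ everywhere Λ f s → below Λ f t ≡ below Λ f s
below-cong K  e _  = e
below-cong GL e e′ = cong₂ _&&_ e e′

graft : Tree → Tree → Tree
graft s (node v ts) = node v (s ∷ ts)

label-graft : ∀ s t x → label (graft s t) x ≡ label t x
label-graft s (node v ts) x = refl

everywhere-graft : ∀ Λ f s t → everywhere Λ f (graft s t) ≡ below Λ f s && everywhere Λ f t
everywhere-graft Λ f s (node v ts) = refl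

relabelᴸ-∈ : ∀ {Λ σ t ts} → t ∈ᴸ ts → relabel Λ σ t ∈ᴸ relabelᴸ Λ σ ts
relabelᴸ-∈ (here refl) = here refl
relabelᴸ-∈ (there t∈)  = there (relabelᴸ-∈ t∈)

relabel-Succ : ∀ {Λ σ t s} → Succ Λ t s → Succ Λ (relabel Λ σ t) (relabel Λ σ s)
relabel-Succ (child s∈)      = child (relabelᴸ-∈ s∈)
relabel-Succ (deeper u∈ u≺s) = deeper (relabelᴸ-∈ u∈) (relabel-Succ u≺s)

-- Paths to a p-node and their tracks

module Tracks (Λ : Logic) (p : Var) where

  infix 9 _⁻ _⁻ᴸ
  _⁻ : Tree → Tree
  _⁻ = relabel Λ λ x → if does (x ≟ p) then `⊥ else var x

  _⁻ᴸ : List Tree → List Tree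
  _⁻ᴸ = relabelᴸ Λ λ x → if does (x ≟ p) then `⊥ else var x

  label⁻-self : ∀ t → label (t ⁻) p ≡ false
  label⁻-self t = trans (relabel-label Λ _ t p) (cong (sat Λ t) (if-self p))

  label⁻-other : ∀ t {x} → x ≢ p → label (t ⁻) x ≡ label t x
  label⁻-other t {x} x≢p = trans (relabel-label Λ _ t x) (cong (sat Λ t) (if-other x≢p))

  -- Mirrors a δ-formula: a `step` witnesses one ◇, which for GL may jump over several levels, and
  -- `end` witnesses the final p.
  data Path (t : Tree) : Set where
    end  : label t p ≡ true → Path t
    step : ∀ {s} → Succ Λ t s → Path s → Path t

  path-length : ∀ {t} → Path t → ℕ
  path-length (end _)    = 0
  path-length (step _ π) = suc (path-length π)

  -- The path with the p-free tree of each of its nodes attached to that node;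
  -- p holds at the end of the path only.
  track : ∀ {t} → Path t → Tree
  track {t} (end _)    = node (label t) (children (t ⁻))
  track {t} (step _ π) = graft (track π) (t ⁻)

-- For K, p is invisible beyond the modal depth.
module _ (p : Var) where
  open Tracks K p

  sat-long-track : ∀ φ {t} (π : Path t) → depth φ < path-length π → sat K (track π) φ ≡ sat K (t ⁻) φ
  -- The grafted child cannot be told by f from s ⁻, which is already a child of t ⁻, so grafting it
  -- does not affect the box.
  sat-long-track-□ : ∀ f {t} (π : Path t) →
    (∀ {s} (ρ : Path s) → suc (path-length ρ) ≡ path-length π → f (track ρ) ≡ f (s ⁻)) →
    0 < path-length π → everywhere K f (track π) ≡ everywhere K f (t ⁻)
  sat-long-track-□ f {t} (step {s} t≺s π) h _ =
    trans (everywhere-graft K f (track π) (t ⁻)) (trans (cong (_&& everywhere K f (t ⁻)) (h π refl))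
      (true-ext (λ e → proj₂ (&&-true⁻ {f (s ⁻)} e))
                λ e → &&-true⁺ (everywhere⁻ {t = t ⁻} e (relabel-Succ t≺s)) e))
  sat-long-track (var x) {t} (step t≺s π) _ = label-graft (track π) (t ⁻) x
  sat-long-track `⊥ π _ = refl
  sat-long-track `⊤ π _ = refl
  sat-long-track (φ `∧ ψ) π lt = cong₂ _&&_
    (sat-long-track φ π (≤-trans (s≤s (m≤m⊔n _ _)) lt))
    (sat-long-track ψ π (≤-trans (s≤s (m≤n⊔m (depth φ) _)) lt))
  sat-long-track (φ `∨ ψ) π lt = cong₂ _||_
    (sat-long-track φ π (≤-trans (s≤s (m≤m⊔n _ _)) lt))
    (sat-long-track ψ π (≤-trans (s≤s (m≤n⊔m (depth φ) _)) lt))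
  sat-long-track (φ `→ ψ) π lt = cong₂ (λ a b → not a || b)
    (sat-long-track φ π (≤-trans (s≤s (m≤m⊔n _ _)) lt))
    (sat-long-track ψ π (≤-trans (s≤s (m≤n⊔m (depth φ) _)) lt))
  sat-long-track (◇ φ) π lt = cong (λ a → not a || false)
    (sat-long-track-□ _ π (λ ρ e → cong (λ a → not a || false)
      (sat-long-track φ ρ (≤-pred (subst (suc (depth φ) <_) (sym e) lt)))) (≤-trans (s≤s z≤n) lt))
  sat-long-track (□ φ) π lt =
    sat-long-track-□ _ π (λ ρ e → sat-long-track φ ρ (≤-pred (subst (suc (depth φ) <_) (sym e) lt)))
      (≤-trans (s≤s z≤n) lt)

-- Agreement of trees on a closed set of atoms

module Agreement (Λ : Logic) (L : List Atom) (closed : Closed L) where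

  infix 4 _≈_
  -- Used in place of bisimilarity: invariance matters only for formulas over L, and each such class
  -- is described by one assignment on L.
  _≈_ : Tree → Tree → Set
  t ≈ s = ∀ {a} → a ∈ᴸ L → theory Λ t a ≡ theory Λ s a

  ≈-sat : ∀ {t s} φ → atoms φ ⊆ᴬ L → t ≈ s → sat Λ t φ ≡ sat Λ s φ
  ≈-sat φ φ⊆ t≈s = trans (sat-ev φ) (trans (ev-cong φ (t≈s ∘ φ⊆)) (sym (sat-ev φ)))

  Below : Formula → Tree → Bool
  Below φ = below Λ (λ s → sat Λ s φ)

  Everywhereᴸ : Formula → List Tree → Bool
  Everywhereᴸ φ = everywhereᴸ Λ (λ s → sat Λ s φ)

  ≈-below : ∀ {t s φ} → box φ ∈ᴸ L → t ≈ s → Below φ t ≡ Below φ s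
  ≈-below {t} {s} {φ} φ∈ t≈s =
    below-cong Λ {t = t} {s} (≈-sat φ (closed φ∈) t≈s) (t≈s φ∈)

  node-cong : ∀ {v w ts ss} → (∀ {x} → var x ∈ᴸ L → v x ≡ w x) → Pointwise _≈_ ts ss → node v ts ≈ node w ss
  node-cong f ps {var x} a∈ = f a∈
  node-cong f ps {box φ} a∈ = go ps
    where
    go : ∀ {ts ss} → Pointwise _≈_ ts ss → Everywhereᴸ φ ts ≡ Everywhereᴸ φ ss
    go []       = refl
    go (p ∷ ps) = cong₂ _&&_ (≈-below a∈ p) (go ps)

  -- Up to agreement on L, t can be added to the children ts.
  record Covers (ts : List Tree) (t : Tree) : Set where
    field covered : ∀ {φ} → box φ ∈ᴸ L → Everywhereᴸ φ ts ≡ true → Below φ t ≡ true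
  open Covers

  covers-∈ : ∀ {ts t} → t ∈ᴸ ts → Covers ts t
  covers-∈ t∈ .covered _ e = everywhereᴸ⁻ _ e t∈

  covers-Succ : ∀ {v ts t} → Succ Λ (node v ts) t → Covers ts t
  covers-Succ {v} {ts} t∈ .covered _ e = everywhere-below {t = node v ts} e t∈

  -- A box is a conjunction over the children, so these may be reordered, repeated, or dropped when
  -- the others cover them.
  node-covers : ∀ {v w ts ss} → (∀ {x} → var x ∈ᴸ L → v x ≡ w x) →
    (∀ {t} → t ∈ᴸ ss → Covers ts t) → (∀ {t} → t ∈ᴸ ts → Covers ss t) → node v ts ≈ node w ss
  node-covers             f g h {var x} a∈ = f a∈
  node-covers {ts = ts} {ss} f g h {box φ} a∈ =
    true-ext (λ e → everywhereᴸ⁺ ss λ t∈ → g t∈ .covered a∈ e)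
             (λ e → everywhereᴸ⁺ ts λ t∈ → h t∈ .covered a∈ e)

  -- A parent sees a child through `Below` alone. Asking for no more than this is what permits
  -- compression, where the new child may carry a different label.
  graft-cong : ∀ {s s′ t t′} → (∀ {φ} → box φ ∈ᴸ L → Below φ s ≡ Below φ s′) →
    t ≈ t′ → graft s t ≈ graft s′ t′
  graft-cong {s} {s′} {node _ _} {node _ _} f g {var x} a∈ = g a∈
  graft-cong {s} {s′} {node _ _} {node _ _} f g {box φ} a∈ = cong₂ _&&_ (f a∈) (g a∈)

-- Splitting the set of p-nodes by additivity

module Splitting (Λ : Logic) (p q : Var) (p≢q : p ≢ q)
                 (L : List Atom) (closed : Closed L) (q∉L : ¬ var q ∈ᴸ L) where
  open Tracks Λ p
  open Agreement Λ L closed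

  -- Split t t₁ t₂: the trees differ only in p, which holds in t where it
  -- holds in t₁ or in t₂.
  data Split : Tree → Tree → Tree → Set
  data Splitᴸ : List Tree → List Tree → List Tree → Set
  data Split where
    node : ∀ {v v₁ v₂ ts ts₁ ts₂} → (∀ {x} → x ≢ p → v₁ x ≡ v x × v₂ x ≡ v x) →
           v p ≡ v₁ p || v₂ p → Splitᴸ ts ts₁ ts₂ → Split (node v ts) (node v₁ ts₁) (node v₂ ts₂)
  data Splitᴸ where
    []  : Splitᴸ [] [] []
    _∷_ : ∀ {t t₁ t₂ ts ts₁ ts₂} → Split t t₁ t₂ → Splitᴸ ts ts₁ ts₂ →
          Splitᴸ (t ∷ ts) (t₁ ∷ ts₁) (t₂ ∷ ts₂)

  _++ˢ_ : ∀ {ts ts₁ ts₂ ss ss₁ ss₂} → Splitᴸ ts ts₁ ts₂ → Splitᴸ ss ss₁ ss₂ →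
          Splitᴸ (ts ++ ss) (ts₁ ++ ss₁) (ts₂ ++ ss₂)
  []       ++ˢ zs = zs
  (z ∷ zs) ++ˢ ws = z ∷ (zs ++ˢ ws)

  split-left : ∀ t → Split t t (t ⁻)
  splitᴸ-left : ∀ ts → Splitᴸ ts ts (ts ⁻ᴸ)
  split-left t@(node v ts) = node (λ x≢p → refl , label⁻-other t x≢p)
    (sym (trans (cong (v p ||_) (label⁻-self t)) (∨-identityʳ (v p)))) (splitᴸ-left ts)
  splitᴸ-left []       = []
  splitᴸ-left (t ∷ ts) = split-left t ∷ splitᴸ-left ts

  split-right : ∀ t → Split t (t ⁻) t
  splitᴸ-right : ∀ ts → Splitᴸ ts (ts ⁻ᴸ) ts
  split-right t@(node v ts) = node (λ x≢p → label⁻-other t x≢p , refl)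
    (sym (cong (_|| v p) (label⁻-self t))) (splitᴸ-right ts)
  splitᴸ-right []       = []
  splitᴸ-right (t ∷ ts) = split-right t ∷ splitᴸ-right ts

  split-none : ∀ t → Split (t ⁻) (t ⁻) (t ⁻)
  splitᴸ-none : ∀ ts → Splitᴸ (ts ⁻ᴸ) (ts ⁻ᴸ) (ts ⁻ᴸ)
  split-none t@(node v ts) = node (λ x≢p → refl , refl) (sym (∨-idem _)) (splitᴸ-none ts)
  splitᴸ-none []       = []
  splitᴸ-none (t ∷ ts) = split-none t ∷ splitᴸ-none ts

  split-graft : ∀ {s s₁ s₂} t → Split s s₁ s₂ → Split (graft s (t ⁻)) (graft s₁ (t ⁻)) (graft s₂ (t ⁻))
  split-graft t@(node v ts) z = node (λ _ → refl , refl) (sym (∨-idem _)) (z ∷ splitᴸ-none ts)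

  -- p is read off the first part and q off the second.
  merge : ∀ {t t₁ t₂} → Split t t₁ t₂ → Tree
  mergeᴸ : ∀ {ts ts₁ ts₂} → Splitᴸ ts ts₁ ts₂ → List Tree
  merge (node {v₁ = v₁} {v₂} f e zs) = node (λ x → if does (x ≟ q) then v₂ p else v₁ x) (mergeᴸ zs)
  mergeᴸ []       = []
  mergeᴸ (z ∷ zs) = merge z ∷ mergeᴸ zs

  fresh : ∀ {x} → var x ∈ᴸ L → x ≢ q
  fresh x∈ refl = q∉L x∈

  p∨q q-for-p : Var → Formula
  p∨q     x = if does (x ≟ p) then var p `∨ var q else var x
  q-for-p x = if does (x ≟ p) then var q else var x

  merge-left : ∀ {t t₁ t₂} (z : Split t t₁ t₂) → merge z ≈ t₁
  mergeᴸ-left : ∀ {ts ts₁ ts₂} (zs : Splitᴸ ts ts₁ ts₂) → Pointwise _≈_ (mergeᴸ zs) ts₁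
  merge-left (node f e zs) = node-cong (if-other ∘ fresh) (mergeᴸ-left zs)
  mergeᴸ-left []       = []
  mergeᴸ-left (z ∷ zs) = merge-left z ∷ mergeᴸ-left zs

  merge-right : ∀ {t t₁ t₂} (z : Split t t₁ t₂) → relabel Λ q-for-p (merge z) ≈ t₂
  mergeᴸ-right : ∀ {ts ts₁ ts₂} (zs : Splitᴸ ts ts₁ ts₂) → Pointwise _≈_ (relabelᴸ Λ q-for-p (mergeᴸ zs)) ts₂
  merge-right z@(node {v₁ = v₁} {v₂} f e zs) = node-cong labels (mergeᴸ-right zs)
    where
    labels : ∀ {x} → var x ∈ᴸ L → sat Λ (merge z) (q-for-p x) ≡ v₂ x
    labels {x} x∈ with x ≟ p
    ... | yes refl = trans (cong (sat Λ (merge z)) (if-self p)) (if-self q)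
    ... | no x≢p   = trans (cong (sat Λ (merge z)) (if-other x≢p))
                       (trans (if-other (fresh x∈)) (trans (proj₁ (f x≢p)) (sym (proj₂ (f x≢p)))))
  mergeᴸ-right []       = []
  mergeᴸ-right (z ∷ zs) = merge-right z ∷ mergeᴸ-right zs

  merge-both : ∀ {t t₁ t₂} (z : Split t t₁ t₂) → relabel Λ p∨q (merge z) ≈ t
  mergeᴸ-both : ∀ {ts ts₁ ts₂} (zs : Splitᴸ ts ts₁ ts₂) → Pointwise _≈_ (relabelᴸ Λ p∨q (mergeᴸ zs)) ts
  merge-both z@(node {v} {v₁} {v₂} f e zs) = node-cong labels (mergeᴸ-both zs)
    where
    labels : ∀ {x} → var x ∈ᴸ L → sat Λ (merge z) (p∨q x) ≡ v x
    labels {x} x∈ with x ≟ p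
    ... | yes refl = trans (cong (sat Λ (merge z)) (if-self p))
                       (trans (cong₂ _||_ (if-other p≢q) (if-self q)) (sym e))
    ... | no x≢p   = trans (cong (sat Λ (merge z)) (if-other x≢p))
                       (trans (if-other (fresh x∈)) (proj₁ (f x≢p)))
  mergeᴸ-both []       = []
  mergeᴸ-both (z ∷ zs) = merge-both z ∷ mergeᴸ-both zs

  -- All that is used of φ from here on; `join` is monotonicity in p. Predicates replace formulas
  -- because descending into a child s of t turns Φ into λ s → Φ (graft s (t ⁻)), which is linear
  -- again but not given by a formula.
  record Linear (Φ : Tree → Set) : Set where
    field
      resp  : ∀ {t s} → t ≈ s → Φ t → Φ s
      split : ∀ {t t₁ t₂} → Split t t₁ t₂ → Φ t → Φ t₁ ⊎ Φ t₂
      join  : ∀ {t t₁ t₂} → Split t t₁ t₂ → Φ t₁ → Φ t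
  open Linear

  linear-graft : ∀ {Φ} t → Linear Φ → Linear λ s → Φ (graft s (t ⁻))
  linear-graft t l .resp s≈s′ = resp l (graft-cong (λ φ∈ → ≈-below φ∈ s≈s′) λ _ → refl)
  linear-graft t l .split z   = split l (split-graft t z)
  linear-graft t l .join z    = join l (split-graft t z)

  -- The merged tree carries both parts at once. Reading p in it as p ∨ q, as p and as q gives back,
  -- up to agreement, the whole tree, the first part and the second part.
  additive-split : ∀ φ → atoms φ ⊆ᴬ L → SemanticallyAdditive Λ p q φ →
    ∀ {t t₁ t₂} → Split t t₁ t₂ → sat Λ t φ ≡ sat Λ t₁ φ || sat Λ t₂ φ
  additive-split φ φ⊆ h z =
    trans (sym (≈-sat φ φ⊆ (merge-both z)))
    (trans (sym (sat-substitute (merge z) φ))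
    (trans (h (merge z))
    (cong₂ _||_ (≈-sat φ φ⊆ (merge-left z))
                (trans (sat-substitute (merge z) φ) (≈-sat φ φ⊆ (merge-right z))))))

  linear-sat : ∀ φ → atoms φ ⊆ᴬ L → SemanticallyAdditive Λ p q φ → Linear λ t → sat Λ t φ ≡ true
  linear-sat φ φ⊆ h .resp t≈s e = trans (sym (≈-sat φ φ⊆ t≈s)) e
  linear-sat φ φ⊆ h .split z e  = ||-true⁻ (trans (sym (additive-split φ φ⊆ h z)) e)
  linear-sat φ φ⊆ h .join z e   = trans (additive-split φ φ⊆ h z) (||-true⁺ˡ e)

  label⁻-false : ∀ {t} → label t p ≡ false → ∀ x → label t x ≡ label (t ⁻) x
  label⁻-false {t} e x with x ≟ p
  ... | yes refl = trans e (sym (label⁻-self t))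
  ... | no x≢p   = sym (label⁻-other t x≢p)

  covers-++ : ∀ {us ts ss} → (∀ {t} → t ∈ᴸ ts → Covers us t) → (∀ {t} → t ∈ᴸ ss → Covers us t) →
              ∀ {t} → t ∈ᴸ ts ++ ss → Covers us t
  covers-++ {ts = ts} f g t∈ with ∈-++⁻ ts t∈
  ... | inj₁ m = f m
  ... | inj₂ m = g m

  covers-∷ : ∀ {us t ts} → Covers us t → (∀ {s} → s ∈ᴸ ts → Covers us s) →
             ∀ {s} → s ∈ᴸ t ∷ ts → Covers us s
  covers-∷ h f (here refl) = h
  covers-∷ h f (there s∈)  = f s∈

  covers-⁻ᴸ : ∀ {us} ts → (∀ {t} → t ∈ᴸ ts → Covers us (t ⁻)) → ∀ {t} → t ∈ᴸ ts ⁻ᴸ → Covers us t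
  covers-⁻ᴸ (t ∷ ts) f (here refl) = f (here refl)
  covers-⁻ᴸ (t ∷ ts) f (there t∈)  = covers-⁻ᴸ ts (f ∘ there) t∈

  Tracked : (Tree → Set) → Tree → Set
  Tracked Φ t = Φ (t ⁻) ⊎ (Σ (Path t) λ π → Φ (track π))

  -- The children are doubled before p is split between the two copies, so
  -- that a child retaining p has a p-free twin.
  descend : ∀ {Φ} → Linear Φ → ∀ t → Φ t → Tracked Φ t
  descend-children : ∀ {Φ} → Linear Φ → ∀ v ts ss → (∀ {s} → s ∈ᴸ ss → s ∈ᴸ ts) →
    Φ (node v (ss ++ ts ⁻ᴸ)) → Tracked Φ (node v ts)
  descend {Φ} l (node v ts) h = descend-children l v ts ts id (halve (split l copies (resp l doubled h)))
    where
    doubled : node v ts ≈ node v (ts ++ ts)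
    doubled = node-covers (λ _ → refl) (covers-++ covers-∈ covers-∈) (covers-∈ ∘ ∈-++⁺ˡ)
    copies : Split (node v (ts ++ ts)) (node v (ts ++ ts ⁻ᴸ)) (node v (ts ⁻ᴸ ++ ts))
    copies = node (λ _ → refl , refl) (sym (∨-idem _)) (splitᴸ-left ts ++ˢ splitᴸ-right ts)
    swap : node v (ts ⁻ᴸ ++ ts) ≈ node v (ts ++ ts ⁻ᴸ)
    swap = node-covers (λ _ → refl)
      (covers-++ (covers-∈ ∘ ∈-++⁺ʳ (ts ⁻ᴸ)) (covers-∈ ∘ ∈-++⁺ˡ))
      (covers-++ (covers-∈ ∘ ∈-++⁺ʳ ts) (covers-∈ ∘ ∈-++⁺ˡ))
    halve : Φ (node v (ts ++ ts ⁻ᴸ)) ⊎ Φ (node v (ts ⁻ᴸ ++ ts)) → Φ (node v (ts ++ ts ⁻ᴸ))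
    halve (inj₁ h) = h
    halve (inj₂ h) = resp l swap h
  -- All children are p-free by now, so p can remain only at the root, where the path then ends.
  descend-children l v ts [] inc h with bool-split (v p)
  ... | inj₁ e = inj₂ (end e , h)
  ... | inj₂ e = inj₁ (resp l (node-covers (λ _ → label⁻-false {node v ts} e _) covers-∈ covers-∈) h)
  descend-children {Φ} l v ts (s ∷ ss) inc h = continue (split l first h)
    where
    t = node v ts
    -- p inside s goes to the first part, p at the root and in the remaining ss to the second.
    first : Split (node v (s ∷ ss ++ ts ⁻ᴸ)) (node (label (t ⁻)) (s ∷ ss ⁻ᴸ ++ ts ⁻ᴸ))
                  (node v (s ⁻ ∷ ss ++ ts ⁻ᴸ))
    first = node (λ x≢p → label⁻-other t x≢p , refl) (sym (cong (_|| v p) (label⁻-self t)))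
      (split-left s ∷ (splitᴸ-right ss ++ˢ splitᴸ-none ts))
    drop-siblings : node (label (t ⁻)) (s ∷ ss ⁻ᴸ ++ ts ⁻ᴸ) ≈ graft s (t ⁻)
    drop-siblings = node-covers (λ _ → refl)
      (covers-∷ (covers-∈ (here refl)) (covers-∈ ∘ there ∘ ∈-++⁺ʳ (ss ⁻ᴸ)))
      (covers-∷ (covers-∈ (here refl))
        (covers-++ (covers-⁻ᴸ ss λ u∈ → covers-∈ (there (relabelᴸ-∈ (inc (there u∈)))))
                   (covers-∈ ∘ there)))
    drop-twin : node v (s ⁻ ∷ ss ++ ts ⁻ᴸ) ≈ node v (ss ++ ts ⁻ᴸ)
    drop-twin = node-covers (λ _ → refl) (covers-∈ ∘ there)
      (covers-∷ (covers-∈ (∈-++⁺ʳ ss (relabelᴸ-∈ (inc (here refl))))) covers-∈)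
    absorb : graft (s ⁻) (t ⁻) ≈ t ⁻
    absorb = node-covers (λ _ → refl) (covers-∈ ∘ there)
      (covers-∷ (covers-∈ (relabelᴸ-∈ (inc (here refl)))) covers-∈)
    extend : Tracked (λ u → Φ (graft u (t ⁻))) s → Tracked Φ t
    extend (inj₁ h)       = inj₁ (resp l absorb h)
    extend (inj₂ (π , h)) = inj₂ (step (child (inc (here refl))) π , h)
    continue : Φ (node (label (t ⁻)) (s ∷ ss ⁻ᴸ ++ ts ⁻ᴸ)) ⊎ Φ (node v (s ⁻ ∷ ss ++ ts ⁻ᴸ)) → Tracked Φ t
    -- p survives inside s only: s becomes the new root, and t ⁻ a fixed context.
    continue (inj₁ h) = extend (descend (linear-graft t l) s (resp l drop-siblings h))
    -- s has lost p and is redundant beside its twin in ts ⁻ᴸ.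
    continue (inj₂ h) = descend-children l v ts ss (inc ∘ there) (resp l drop-twin h)

  -- Only monotonicity and redundancy are used: putting the real subtrees in place of their p-free
  -- copies just adds p, and the extra child s can then be dropped, being a successor of t already.
  ascend : ∀ {Φ} → Linear Φ → ∀ {t} (π : Path t) → Φ (track π) → Φ t
  ascend l {node v ts} (end e) h =
    join l (node (λ _ → refl , refl) (sym (∨-idem _)) (splitᴸ-right ts)) h
  ascend l {t@(node v ts)} (step {s} t≺s π) h =
    resp l absorb (join l widen (ascend (linear-graft t l) π h))
    where
    widen : Split (node v (s ∷ ts)) (graft s (t ⁻)) (node v (s ⁻ ∷ ts))
    widen = node (λ x≢p → label⁻-other t x≢p , refl) (sym (cong (_|| v p) (label⁻-self t)))
      (split-left s ∷ splitᴸ-right ts)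
    absorb : node v (s ∷ ts) ≈ t
    absorb = node-covers (λ _ → refl) (covers-∈ ∘ there) (covers-∷ (covers-Succ t≺s) covers-∈)

-- For GL, a node of a path can be left out if every φ with □ φ in L that fails
-- at or below that node of the track also fails at or below the next one.
module _ (p : Var) (L : List Atom) (closed : Closed L) where
  open Tracks GL p
  open Agreement GL L closed

  failing : ∀ {t} → Path t → Assignment
  failing π (var x) = false
  failing π (box φ) = not (Below φ (track π))

  Similar : ∀ {t s} → Path t → Path s → Set
  Similar π ρ = ∀ {φ} → box φ ∈ᴸ L → Below φ (track π) ≡ Below φ (track ρ)

  reach : ∀ {t s u} → Succ GL t s → u ≡ s ⊎ Succ GL s u → Succ GL t u
  reach t≺s (inj₁ refl) = t≺s
  reach t≺s (inj₂ s≺u)  = Succ-trans t≺s s≺u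

  -- Works backwards from the end of the path. A node is kept only if something fails at or below it
  -- that does not fail further along, so each kept step raises the count of failing boxes. Dropping
  -- nodes at the front moves the start, hence the s.
  compress : ∀ {t} (π : Path t) → ∃[ s ] (s ≡ t ⊎ Succ GL t s) × (Σ (Path s) λ ρ →
             path-length ρ ≤ count (failing ρ) L × Similar ρ π)
  compress {t} (end e) = t , inj₁ refl , end e , z≤n , λ _ → refl
  compress {t} (step {s} t≺s π) with compress π
  ... | u , rel , ρ , len , sim = conclude (search L λ {a} → test a)
    where
    t≺u : Succ GL t u
    t≺u = reach t≺s rel
    ρ′ : Path t
    ρ′ = step t≺u ρ
    similar : Similar ρ′ (step t≺s π)
    similar φ∈ = ≈-below φ∈ (graft-cong {t = t ⁻} {t ⁻} sim λ _ → refl)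
    -- For GL, `Below` at a node covers everything at or below its successors, so failures persist
    -- backwards along the path.
    keeps : ∀ a → failing ρ a ≡ true → failing ρ′ a ≡ true
    keeps (box φ) e = cong not (≢true⇒≡false λ e₁ → true≢false
      (proj₁ (&&-true⁻ {Below φ (track ρ)}
        (trans (sym (everywhere-graft GL (λ s → sat GL s φ) (track ρ) (t ⁻)))
               (proj₂ (&&-true⁻ {sat GL (track ρ′) φ} e₁)))))
      (not-true e))
    test : ∀ a → a ∈ᴸ L → failing ρ′ a ≡ failing ρ a ⊎ (failing ρ a ≡ false × failing ρ′ a ≡ true)
    test a _ with failing ρ a in e | failing ρ′ a in e′
    ... | true  | true  = inj₁ refl
    ... | false | false = inj₁ refl
    ... | false | true  = inj₂ (refl , refl)
    ... | true  | false = true≢false (keeps a e) e′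
    conclude : (∀ {a} → a ∈ᴸ L → failing ρ′ a ≡ failing ρ a) ⊎
               (∃[ a ] a ∈ᴸ L × failing ρ a ≡ false × failing ρ′ a ≡ true) →
               ∃[ s ] (s ≡ t ⊎ Succ GL t s) × (Σ (Path s) λ ρ →
                 path-length ρ ≤ count (failing ρ) L × Similar ρ (step t≺s π))
    conclude (inj₁ same) = u , inj₂ t≺u , ρ , len , λ φ∈ →
      trans (sym (not-injective (same φ∈))) (similar φ∈)
    conclude (inj₂ (a , a∈ , e , e′)) = t , inj₁ refl , ρ′ ,
      ≤-trans (s≤s len) (count-< L (λ {b} _ → keeps b) a∈ e e′) , similar

  -- Compression preserves only `Below`, whereas agreement of the tracks also involves the variables
  -- at the root. The first node is therefore kept in any case, at the cost of the `suc`.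
  compress-step : ∀ {t} (π : Path t) → Σ (Path t) λ ρ → path-length ρ ≤ suc (length L) × track ρ ≈ track π
  compress-step (end e) = end e , z≤n , λ _ → refl
  compress-step {t} (step {s} t≺s π) with compress π
  ... | u , rel , ρ , len , sim =
    step (reach t≺s rel) ρ , s≤s (≤-trans len (count-≤-length _ L)) , graft-cong {t = t ⁻} {t ⁻} sim λ _ → refl

-- The first term serves K, where longer tracks reduce to the p-free tree; the second serves GL,
-- where paths are compressed.
bound : Formula → ℕ
bound φ = depth φ ⊔ suc (length (atoms φ))

short-path : ∀ Λ p φ {t} (π : Tracks.Path Λ p t) → let open Tracks Λ p in
  sat Λ (track π) φ ≡ true →
  sat Λ (t ⁻) φ ≡ true ⊎ (Σ (Path t) λ ρ → path-length ρ ≤ bound φ × sat Λ (track ρ) φ ≡ true)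
short-path K p φ π e with Tracks.path-length K p π ≤? depth φ
... | yes le = inj₂ (π , ≤-trans le (m≤m⊔n _ _) , e)
... | no  nle = inj₁ (trans (sym (sat-long-track p φ π (≰⇒> nle))) e)
short-path GL p φ π e =
  let ρ , len , sim = compress-step p (atoms φ) (atoms-closed φ) π in
  inj₂ (ρ , ≤-trans len (m≤n⊔m (depth φ) _) ,
    trans (Agreement.≈-sat GL (atoms φ) (atoms-closed φ) φ id sim) e)

-- δ-formulas that spell out paths

words : List Assignment → ∀ m → List (Vec Assignment (suc m))
words vs zero    = map (_∷ []) vs
words vs (suc m) = cartesianProductWith _∷_ vs (words vs m)

module Letters (Λ : Logic) (p : Var) (L : List Atom) (closed : Closed L) where
  open Tracks Λ p
  open Agreement Λ L closed

  -- The substitution removes p, as the ϰ of a δ-formula must be p-free; the result, evaluated at t,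
  -- describes t ⁻.
  letter : Assignment → Formula
  letter v = literals v L [ p ≔ `⊥ ]

  Spells : Tree → Assignment → Set
  Spells t v = Realizes Λ (t ⁻) v L

  data Spelling : ∀ {t m} → Path t → Vec Assignment (suc m) → Set where
    end  : ∀ {t v} {e : label t p ≡ true} → Spells t v → Spelling {t} (end e) (v ∷ [])
    step : ∀ {t s v m} {vs : Vec Assignment (suc m)} {t≺s : Succ Λ t s} {π : Path s} →
           Spells t v → Spelling π vs → Spelling {t} (step t≺s π) (v ∷ vs)

  sat-literals⁺ : ∀ {t v} → Realizes Λ t v L → sat Λ t (literals v L) ≡ true
  sat-literals⁺ {t} {v} f = trans (sat-ev (literals v L)) (ev-literals⁺ {theory Λ t} {v} L f)

  sat-letter⁺ : ∀ {t v} → Spells t v → sat Λ t (letter v) ≡ true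
  sat-letter⁺ {t} {v} f = trans (sat-substitute t (literals v L)) (sat-literals⁺ {t ⁻} {v} f)

  sat-letter⁻ : ∀ {t v} → sat Λ t (letter v) ≡ true → Spells t v
  sat-letter⁻ {t} {v} e = ev-literals⁻ {theory Λ (t ⁻)} {v} L
    (trans (sym (sat-ev (literals v L))) (trans (sym (sat-substitute t (literals v L))) e))

  word-formula : ∀ {m} → Vec Assignment (suc m) → Formula
  word-formula vs = δ p (Vec.map letter vs)

  sat-word⁺ : ∀ {t m} {π : Path t} {vs : Vec Assignment (suc m)} → Spelling π vs →
              sat Λ t (word-formula vs) ≡ true
  sat-word⁺ (end {t} {v} {e} f) = &&-true⁺ (sat-letter⁺ {t} {v} f) e
  sat-word⁺ (step {t} {s} {v} {vs = vs@(_ ∷ _)} {t≺s} f z) =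
    &&-true⁺ (sat-letter⁺ {t} {v} f) (sat-◇⁺ (word-formula vs) t≺s (sat-word⁺ z))

  sat-word⁻ : ∀ {t m} (vs : Vec Assignment (suc m)) → sat Λ t (word-formula vs) ≡ true →
              Σ (Path t) λ π → Spelling π vs
  sat-word⁻ {t} (v ∷ []) e =
    let e₁ , e₂ = &&-true⁻ e in end e₂ , end (sat-letter⁻ {t} {v} e₁)
  sat-word⁻ {t} (v ∷ vs@(_ ∷ _)) e =
    let e₁ , e₂       = &&-true⁻ {sat Λ t (letter v)} e
        s , t≺s , e₃  = sat-◇⁻ {Λ} {t} (word-formula vs) e₂
        π , z         = sat-word⁻ vs e₃
    in step t≺s π , step (sat-letter⁻ {t} {v} e₁) z

  spell : ∀ {t} (π : Path t) → ∃[ vs ] vs ∈ᴸ words (assignments L) (path-length π) × Spelling π vs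
  spell {t} (end e) =
    let v , v∈ , f = assignments-complete (theory Λ (t ⁻)) L in v ∷ [] , ∈-map⁺ (_∷ []) v∈ , end f
  spell {t} (step t≺s π) =
    let v , v∈ , f   = assignments-complete (theory Λ (t ⁻)) L
        vs , vs∈ , z = spell π
    in v ∷ vs , ∈-cartesianProductWith⁺ _∷_ v∈ vs∈ , step f z

  -- A track is assembled from the p-free copies of its nodes, with p added at the end. The letters
  -- record these copies up to agreement, so the word determines the track.
  track-cong : ∀ {t s m} {π : Path t} {ρ : Path s} {vs : Vec Assignment (suc m)} →
               Spelling π vs → Spelling ρ vs → track π ≈ track ρ
  track-cong {t} {s} (end {e = e} f) (end {e = e′} g) {var x} a∈ with x ≟ p
  ... | yes refl = trans e (sym e′)
  ... | no x≢p   = trans (sym (label⁻-other t x≢p)) (trans (f a∈) (trans (sym (g a∈)) (label⁻-other s x≢p)))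
  track-cong {node _ _} {node _ _} (end f) (end g) {box φ} a∈ = trans (f a∈) (sym (g a∈))
  track-cong {t} {s} (step f z) (step g w) = graft-cong {t = t ⁻} {s ⁻}
    (λ φ∈ → ≈-below φ∈ (track-cong z w)) λ a∈ → trans (f a∈) (sym (g a∈))

atoms-∈Fm : ∀ {n} {xs : Vec Var n} φ → φ ∈Fm[ xs ] → ∀ {a} → a ∈ᴸ atoms φ → ⌜ a ⌝ ∈Fm[ xs ]
atoms-∈Fm-++ : ∀ {n} {xs : Vec Var n} φ ψ → φ ∈Fm[ xs ] × ψ ∈Fm[ xs ] →
               ∀ {a} → a ∈ᴸ atoms φ ++ atoms ψ → ⌜ a ⌝ ∈Fm[ xs ]
atoms-∈Fm-++ φ ψ (φ∈ , ψ∈) a∈ with ∈-++⁻ (atoms φ) a∈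
... | inj₁ m = atoms-∈Fm φ φ∈ m
... | inj₂ m = atoms-∈Fm ψ ψ∈ m
atoms-∈Fm (var x)  x∈ (here refl) = x∈
atoms-∈Fm (φ `∧ ψ) h  a∈          = atoms-∈Fm-++ φ ψ h a∈
atoms-∈Fm (φ `∨ ψ) h  a∈          = atoms-∈Fm-++ φ ψ h a∈
atoms-∈Fm (φ `→ ψ) h  a∈          = atoms-∈Fm-++ φ ψ h a∈
atoms-∈Fm (◇ φ)    φ∈ (here refl) = φ∈ , tt
atoms-∈Fm (◇ φ)    φ∈ (there a∈)  = atoms-∈Fm φ φ∈ a∈
atoms-∈Fm (□ φ)    φ∈ (here refl) = φ∈
atoms-∈Fm (□ φ)    φ∈ (there a∈)  = atoms-∈Fm φ φ∈ a∈

literals-∈Fm : ∀ {n} {xs : Vec Var n} v L → (∀ {a} → a ∈ᴸ L → ⌜ a ⌝ ∈Fm[ xs ]) → literals v L ∈Fm[ xs ]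
literals-∈Fm v []      f = tt
literals-∈Fm v (a ∷ L) f with v a
... | true  = f (here refl) , literals-∈Fm v L (f ∘ there)
... | false = (f (here refl) , tt) , literals-∈Fm v L (f ∘ there)

substitute-∈Fm : ∀ {n} {r : Vec Var n} {p χ} → χ ∈Fm[ r ] → ∀ φ → φ ∈Fm[ p ∷ r ] → φ [ p ≔ χ ] ∈Fm[ r ]
substitute-∈Fm {p = p} χ∈ (var x) x∈ with x ≟ p | x∈
... | yes refl | _ = subst _∈Fm[ _ ] (sym (if-self p)) χ∈
... | no x≢p | here e = ⊥-elim (x≢p e)
... | no x≢p | there m = subst _∈Fm[ _ ] (sym (if-other x≢p)) m
substitute-∈Fm χ∈ `⊥       _         = tt
substitute-∈Fm χ∈ `⊤       _         = tt
substitute-∈Fm χ∈ (φ `∧ ψ) (φ∈ , ψ∈) = substitute-∈Fm χ∈ φ φ∈ , substitute-∈Fm χ∈ ψ ψ∈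
substitute-∈Fm χ∈ (φ `∨ ψ) (φ∈ , ψ∈) = substitute-∈Fm χ∈ φ φ∈ , substitute-∈Fm χ∈ ψ ψ∈
substitute-∈Fm χ∈ (φ `→ ψ) (φ∈ , ψ∈) = substitute-∈Fm χ∈ φ φ∈ , substitute-∈Fm χ∈ ψ ψ∈
substitute-∈Fm χ∈ (◇ φ)    φ∈        = substitute-∈Fm χ∈ φ φ∈
substitute-∈Fm χ∈ (□ φ)    φ∈        = substitute-∈Fm χ∈ φ φ∈

sat-⋁⁺ : ∀ {Λ t φ} Γ → φ ∈ᴸ Γ → sat Λ t φ ≡ true → sat Λ t (⋁ Γ) ≡ true
sat-⋁⁺ (φ ∷ Γ) (here refl) e = ||-true⁺ˡ e
sat-⋁⁺ {Λ} {t} (φ ∷ Γ) (there m) e = ||-true⁺ʳ {sat Λ t φ} (sat-⋁⁺ Γ m e)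

sat-⋁⁻ : ∀ {Λ t} Γ → sat Λ t (⋁ Γ) ≡ true → ∃[ φ ] φ ∈ᴸ Γ × sat Λ t φ ≡ true
sat-⋁⁻ {Λ} {t} (φ ∷ Γ) e with ||-true⁻ {sat Λ t φ} e
... | inj₁ e₁ = φ , here refl , e₁
... | inj₂ e₁ = let ψ , m , e₂ = sat-⋁⁻ Γ e₁ in ψ , there m , e₂

-- The normal form of an additive formula

module NormalForm (Λ : Logic) (p q : Var) {n} (r : Vec Var n) (p≢q : p ≢ q) (q∉r : q ∉ r)
         (φ : Formula) (φ∈ : φ ∈Fm[ p ∷ r ]) (additive : Additive Λ p q φ) where
  open Tracks Λ p
  open Agreement Λ (atoms φ) (atoms-closed φ)
  open Letters Λ p (atoms φ) (atoms-closed φ)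

  q∉φ : ¬ var q ∈ᴸ atoms φ
  q∉φ q∈ with atoms-∈Fm φ φ∈ q∈
  ... | here e  = p≢q (sym e)
  ... | there m = q∉r m

  open Splitting Λ p q p≢q (atoms φ) (atoms-closed φ) q∉φ

  linear : Linear λ t → sat Λ t φ ≡ true
  linear = linear-sat φ id (additive⁻ additive)

  constant-part : Formula
  constant-part = φ [ p ≔ `⊥ ]

  constant-sat : ∀ t → sat Λ t constant-part ≡ sat Λ (t ⁻) φ
  constant-sat t = sat-substitute t φ

  candidates : List Formula
  -- A path of m steps has m + 1 letters; `upTo` excludes its argument, and the `suc` admits paths
  -- of length exactly `bound φ`.
  candidates = concatMap (λ m → map word-formula (words (assignments (atoms φ)) m)) (upTo (suc (bound φ)))

  -- With this choice the disjunction implies φ by soundness; that enough words pass the filter is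
  -- shown in `summand`.
  summands : List Formula
  summands = filter (λ ψ → derivable? Λ (ψ `→ φ)) candidates

  normal-form : Formula
  normal-form = ⋁ summands `∨ constant-part

  word-formula-∈Δ : ∀ {m} (vs : Vec Assignment (suc m)) → Δ p r (word-formula vs)
  word-formula-∈Δ {m} vs = m , Vec.map letter vs , letters vs , refl
    where
    letters : ∀ {k} (vs : Vec Assignment k) → All (_∈Fm[ r ]) (Vec.map letter vs)
    letters []       = []
    letters (v ∷ vs) = substitute-∈Fm {χ = `⊥} tt (literals v (atoms φ))
                         (literals-∈Fm v (atoms φ) (atoms-∈Fm φ φ∈)) ∷ letters vs

  summand-∈Δ : ∀ {ψ} → ψ ∈ᴸ summands → Δ p r ψ
  summand-∈Δ ψ∈ with m , m∈ ← satisfied (∈-concatMap⁻ _ {xs = upTo (suc (bound φ))}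
                                    (proj₁ (∈-filter⁻ _ {xs = candidates} ψ∈)))
    with vs , _ , refl ← ∈-map⁻ word-formula m∈ = word-formula-∈Δ vs

  normal-form-∈A₀ : A₀ p r normal-form
  normal-form-∈A₀ = summands , constant-part , tabulate summand-∈Δ ,
    substitute-∈Fm {χ = `⊥} tt φ φ∈ , refl

  -- A path spelling the word of a path π with track π ⊨ φ has a track
  -- agreeing with that of π.
  summand : ∀ {t} (π : Path t) → path-length π ≤ bound φ → sat Λ (track π) φ ≡ true →
            ∃[ ψ ] ψ ∈ᴸ summands × sat Λ t ψ ≡ true
  summand π le e with vs , vs∈ , z ← spell π =
    word-formula vs , ∈-filter⁺ _ candidate (complete sufficient) , sat-word⁺ z
    where
    candidate : word-formula vs ∈ᴸ candidates
    candidate = ∈-concatMap⁺ _ (lose (∈-upTo⁺ (s≤s le)) (∈-map⁺ word-formula vs∈))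
    sufficient : ∀ s → sat Λ s (word-formula vs `→ φ) ≡ true
    sufficient s = imp-true⁺ λ e′ → let ρ , w = sat-word⁻ vs e′ in
      ascend linear ρ (trans (≈-sat φ id (track-cong w z)) e)

  to-normal-form : ∀ t → sat Λ t φ ≡ true → sat Λ t normal-form ≡ true
  to-normal-form t e = finish (descend linear t e)
    where
    constant : sat Λ (t ⁻) φ ≡ true → sat Λ t normal-form ≡ true
    constant e = ||-true⁺ʳ {sat Λ t (⋁ summands)} (trans (constant-sat t) e)
    finish : Tracked (λ t → sat Λ t φ ≡ true) t → sat Λ t normal-form ≡ true
    finish (inj₁ e)       = constant e
    finish (inj₂ (π , e)) with short-path Λ p φ π e
    ... | inj₁ e₁            = constant e₁
    ... | inj₂ (ρ , le , e₁) = let ψ , ψ∈ , e₂ = summand ρ le e₁ in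
                               ||-true⁺ˡ (sat-⋁⁺ summands ψ∈ e₂)

  from-normal-form : ∀ t → sat Λ t normal-form ≡ true → sat Λ t φ ≡ true
  from-normal-form t e with ||-true⁻ {sat Λ t (⋁ summands)} e
  ... | inj₁ e₁ = let ψ , ψ∈ , e₂ = sat-⋁⁻ summands e₁ in
                  imp-true⁻ (sound (proj₂ (∈-filter⁻ _ {xs = candidates} ψ∈)) t) e₂
  -- Monotonicity in p, from the empty set to the actual one.
  ... | inj₂ e₁ = Linear.join linear (split-right t) (trans (sym (constant-sat t)) e₁)

  normal-form-equivalent : Equivalent Λ φ normal-form
  normal-form-equivalent = complete λ t → iff-true⁺ (true-ext (to-normal-form t) (from-normal-form t))

theorem5p6 : (Λ : Logic) (p q : Var) (n : ℕ) (r : Vec Var n) → p ≢ q → p ∉ r → q ∉ r →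
    (φ : Formula) → φ ∈Fm[ p ∷ r ] →
    Additive Λ p q φ ⇔ (∃[ ψ ] A₀ p r ψ × Equivalent Λ φ ψ)
theorem5p6 Λ p q n r p≢q p∉r q∉r φ φ∈ = mk⇔
  (λ additive → let module N = NormalForm Λ p q r p≢q q∉r φ φ∈ additive in
    N.normal-form , N.normal-form-∈A₀ , N.normal-form-equivalent)
  λ { (ψ , ψ∈ , eq) → additive⁺ (additive-cong {Λ} eq (additive-A₀ p∉r ψ∈)) }
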